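{- Let $n\ge2$ and $q=p^h$ with $p$ prime, $h\geq1$. Let $B$ be a minimal blocking set with respect to lines of $PG(n,q)$ such that every line meets $B$ in $1\pmod{p^e}$ points, where $e$ is the largest integer with this property. Assume $p^e>3$ and $\theta_{n-1}<|B|<2q^{n-1}$. Then $$|B|\leq q^{n-1}+\frac{2q^{n-1}}{p^e}.$$
   Context: $\theta_m=(q^{m+1}-1)/(q-1)$. A blocking set with respect to lines is a point set meeting every line. It is minimal if no proper subset is a blocking set. -}

module Defs where

open import Algebra.Apartness.Bundles using (HeytingField)
import Algebra.Apartness.Properties.HeytingCommutativeRing as HCR
open import Algebra.Bundles using (CommutativeRing)
open import Data.Fin.Base using (Fin)
open import Data.Nat.Base as ℕ
  using (ℕ; suc; _^_; _∸_; _/_; _≥_; ∣_-_∣; NonZero; NonTrivial; s≤s; z≤n)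
open import Data.Nat.Divisibility using (_∣_)
open import Data.Nat.Primality using (Prime; prime⇒nonZero; prime⇒nonTrivial)
import Data.Nat.Properties as ℕ
open import Data.Product.Base using (Σ; ∃; _×_; _,_; proj₁)
open import Data.Vec.Functional using (Vector)
open import Function.Bundles using (Bijection)
open import Level using (_⊔_) renaming (suc to lsuc)
open import Relation.Binary.Bundles using (Setoid)
import Relation.Binary.Construct.On as On
open import Relation.Binary.Definitions using (_Respects_)
import Relation.Binary.PropositionalEquality as ≡
open import Relation.Nullary.Negation.Core using (¬_)
open import Relation.Unary using (Pred; Decidable; _≬_; _∩_; _⊂_)

pred-nonZero : ∀ q → .{{NonTrivial q}} → NonZero (q ∸ 1)
pred-nonZero (suc (suc _)) = _

θ : (q m : ℕ) → .{{NonTrivial q}} → ℕ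
θ q m = (q ^ (m ℕ.+ 1) ∸ 1) / (q ∸ 1)
  where instance _ = pred-nonZero q

primePower-nonZero : ∀ {p} → Prime p → ∀ e → NonZero (p ^ e)
primePower-nonZero {p} pp e = ℕ.m^n≢0 p e {{prime⇒nonZero pp}}

primePower-nonTrivial : ∀ {p} → Prime p → ∀ {h} → h ≥ 1 → NonTrivial (p ^ h)
primePower-nonTrivial {p} pp {suc h} (s≤s z≤n) =
  ℕ.n>1⇒nonTrivial (ℕ.<-≤-trans (ℕ.nonTrivial⇒n>1 p {{prime⇒nonTrivial pp}})
                                (ℕ.m≤m*n p (p ^ h) {{primePower-nonZero pp h}}))

HasSize : ∀ {a ℓ} → Setoid a ℓ → ℕ → Set (a ⊔ ℓ)
HasSize S k = Bijection (≡.setoid (Fin k)) S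

-- PG(n, F), the projective space of dimension n over F.  In a Heyting
-- field x # 0# means that x is invertible, and 1# # 0#; if F is finite
-- then x # y is the same as ¬ x ≈ y.

module PG {c ℓ₁ ℓ₂} (F : HeytingField c ℓ₁ ℓ₂) (n : ℕ) where

  private
    module F = HeytingField F
    open F using (Carrier; _≈_; _#_; _+_; _*_; 0#; 1#; #⇒invertible)
    open HCR F.heytingCommutativeRing
      using (1#0; x-0≈x; invertibleˡ⇒#; x#0y#0→xy#0)

  -- A point is represented by a nonzero vector spanning it, so it is
  -- to be taken up to proportionality, _≈ₚ_.

  Point : Set (c ⊔ ℓ₂)
  Point = Σ (Vector Carrier (suc n)) λ v → ∃ λ i → v i # 0#

  infix 4 _≈ₚ_

  _≈ₚ_ : Point → Point → Set (c ⊔ ℓ₁ ⊔ ℓ₂)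
  (v , _) ≈ₚ (w , _) = ∃ λ a → a # 0# × (∀ i → v i ≈ a * w i)

  private
    inverse : ∀ {a} → a # 0# → ∃ λ b → b # 0# × b * a ≈ 1#
    inverse {a} a#0 with #⇒invertible a#0
    ... | b , b[a-0]≈1 , _ = b , invertibleˡ⇒# (a , a[b-0]≈1) , ba≈1
      where
      ba≈1 : b * a ≈ 1#
      ba≈1 = F.trans (F.*-congˡ (F.sym (x-0≈x a))) b[a-0]≈1

      a[b-0]≈1 : a * (b F.- 0#) ≈ 1#
      a[b-0]≈1 = F.trans (F.*-congˡ (x-0≈x b)) (F.trans (F.*-comm a b) ba≈1)

    ≈ₚ-refl : ∀ {P} → P ≈ₚ P
    ≈ₚ-refl = 1# , 1#0 , λ i → F.sym (F.*-identityˡ _)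

    ≈ₚ-sym : ∀ {P Q} → P ≈ₚ Q → Q ≈ₚ P
    ≈ₚ-sym (a , a#0 , v≈aw) with inverse a#0
    ... | b , b#0 , ba≈1 = b , b#0 , λ i →
      F.sym (F.trans (F.*-congˡ (v≈aw i))
            (F.trans (F.sym (F.*-assoc b a _))
            (F.trans (F.*-congʳ ba≈1) (F.*-identityˡ _))))

    ≈ₚ-trans : ∀ {P Q R} → P ≈ₚ Q → Q ≈ₚ R → P ≈ₚ R
    ≈ₚ-trans (a , a#0 , u≈av) (b , b#0 , v≈bw) =
      a * b , x#0y#0→xy#0 a#0 b#0 , λ i →
        F.trans (u≈av i) (F.trans (F.*-congˡ (v≈bw i)) (F.sym (F.*-assoc a b _)))

  pointSetoid : Setoid (c ⊔ ℓ₂) (c ⊔ ℓ₁ ⊔ ℓ₂)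
  pointSetoid = record
    { Carrier       = Point
    ; _≈_           = _≈ₚ_
    ; isEquivalence = record
      { refl  = λ {P} → ≈ₚ-refl {P}
      ; sym   = λ {P} {Q} → ≈ₚ-sym {P} {Q}
      ; trans = λ {P} {Q} {R} → ≈ₚ-trans {P} {Q} {R}
      }
    }

  -- A line is given by two distinct points on it.

  record Line : Set (c ⊔ ℓ₁ ⊔ ℓ₂) where
    field
      P Q : Point
      P≉Q : ¬ P ≈ₚ Q

  OnLine : Line → Pred Point (c ⊔ ℓ₁)
  OnLine L (x , _) = ∃ λ a → ∃ λ b → ∀ i → x i ≈ a * proj₁ P i + b * proj₁ Q i
    where open Line L

  -- Every subset of a finite set is classically decidable.

  record PointSet s : Set (c ⊔ ℓ₁ ⊔ ℓ₂ ⊔ lsuc s) where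
    field
      Member   : Pred Point s
      respects : Member Respects _≈ₚ_
      member?  : Decidable Member

  open PointSet public using (Member)

  Card : ∀ {s} → Pred Point s → ℕ → Set (c ⊔ ℓ₁ ⊔ ℓ₂ ⊔ s)
  Card A = HasSize (On.setoid {B = ∃ A} pointSetoid proj₁)

  IsBlocking : ∀ {s} → PointSet s → Set (c ⊔ ℓ₁ ⊔ ℓ₂ ⊔ s)
  IsBlocking B = ∀ L → Member B ≬ OnLine L

  IsMinimalBlocking : ∀ {s} → PointSet s → Set (c ⊔ ℓ₁ ⊔ ℓ₂ ⊔ lsuc s)
  IsMinimalBlocking {s} B =
    IsBlocking B × (∀ (A : PointSet s) → Member A ⊂ Member B → ¬ IsBlocking A)

  MeetsLinesIn1Mod : ∀ {s} → PointSet s → ℕ → Set (c ⊔ ℓ₁ ⊔ ℓ₂ ⊔ s)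
  MeetsLinesIn1Mod B d =
    ∀ L → ∃ λ k → Card (Member B ∩ OnLine L) k × d ∣ ∣ k - 1 ∣

{-# OPTIONS --safe #-}

-- Put E = pᵉ, Q = qⁿ⁻¹, and let k be the number of points of B on a line.
-- Since k ≡ 1 (mod E), every line has (k - 1)(k - 1 - E) ≥ 0.  Summing over
-- all lines gives a quadratic inequality in b = |B|, which together with
-- b > θₙ₋₁ implies b² ≥ (1 + E) Q (b - Q).  For E > 3 this fails whenever
-- Q + 2Q/E < b < 2Q.
--
-- The sum over the lines is taken as a sum over pairs of vectors (u, v),
-- where each line ⟨u, v⟩ occurs equally often.  With χ the indicator of the
-- vectors spanning a point of B, the number k is Σ_c χ (v + c u) + χ u, so
-- that its first two moments follow from translation and scaling invariance.
-- The dependent pairs contribute known terms.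

module Submission where

open import Algebra.Apartness.Bundles using (HeytingCommutativeRing; HeytingField)
import Algebra.Apartness.Properties.HeytingCommutativeRing as HeytingProperties
open import Algebra.Bundles using (CommutativeRing)
import Algebra.Definitions.RawMonoid as RawMonoid
import Algebra.Properties.CommutativeSemigroup as CommutativeSemigroupProperties
import Algebra.Properties.Ring as RingProperties
import Algebra.Properties.Semiring.Sum as SemiringSum
open import Data.Bool.Base using (if_then_else_)
open import Data.Fin.Base using (Fin; zero; suc; combine; funToFin; finToFun)
import Data.Fin.Permutation as Perm
import Data.Fin.Properties as Fin
import Data.Integer.Base as ℤ
import Data.Integer.Properties as ℤₚ
open import Data.Nat.Base as ℕ using (ℕ; zero; suc; ∣_-_∣)
open import Data.Nat.Divisibility using (_∣_; ∣⇒≤)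
open import Data.Nat.DivMod using (m*n/n≡m)
open import Data.Nat.Primality using (Prime)
import Data.Nat.Properties as ℕ
open import Data.Nat.Tactic.RingSolver using (solve-∀)
open import Data.Product.Base using (Σ; ∃; _×_; _,_; proj₁; proj₂)
import Data.Rational.Base as ℚ
import Data.Rational.Properties as ℚ
open import Data.Rational.Unnormalised.Base as ℚᵘ using (mkℚᵘ; *≤*)
import Data.Rational.Unnormalised.Properties as ℚᵘ
open import Data.Unit.Base using (tt)
open import Data.Vec.Functional using (Vector)
import Data.Vec.Functional.Relation.Binary.Equality.Setoid as VectorEquality
open import Defs
open import Function.Base using (_∘_; id)
open import Function.Bundles using (Bijection)
open import Level using (Level; _⊔_)
open import Relation.Binary.Bundles using (Setoid)
open import Relation.Binary.Core using (_Preserves_⟶_)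
open import Relation.Binary.Definitions using (_Respects_) renaming (Decidable to Decidable₂)
open import Relation.Binary.PropositionalEquality as ≡ using (_≡_)
import Relation.Binary.Reasoning.Setoid as SetoidReasoning
open import Relation.Nullary.Decidable.Core using (Dec; yes; no; does; map′; _×-dec_; ¬?)
open import Relation.Nullary.Negation.Core using (¬_; contradiction)
open import Relation.Unary using (Pred; Decidable; _∩_)

-- A `Line` is presented by two of its points, so one line has many presentations and no list of
-- lines is at hand to sum over. Vectors, in contrast, are enumerated as tuples over a field with q
-- elements. With r = q - 1, a line has (q² - 1)(q² - q) = (1 + q) q r² ordered bases. This is the
-- origin of the factor q r² that is cancelled at the end, while 1 + q clears the denominator in the
-- number of lines. The price is an asymmetry between u and v: the vectors v + c u never span the
-- point ⟨u⟩, so their count is k - 1 or k according as u is in B or not, and the single inequality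
-- for k is used in two forms. Since the invariance arguments need sums over all pairs, the
-- dependent ones cannot be left out; they enter as equalities, so that nothing is lost. All of this
-- takes place in `ℕ`, where subtraction truncates. Negative terms are therefore moved to the other
-- side of each inequality.

module Inequalities where

  -- Arithmetic: from the line count to the bound on b.

  open import Data.Nat.Base
  open import Data.Nat.Properties
  open ≡ using (refl; sym; trans; cong; subst; subst₂; module ≡-Reasoning)

  -- As a function of `d` the difference (Q + d)² - (1 + E) Q d is convex. At d = Q it equals (3 -
  -- E) Q², at d = 2Q/E it equals (4 + 2E - E²) Q²/E², and both values are negative once E ≥ 4.
  quadratic-gap : ∀ E Q d → E > 3 → d < Q → 2 * Q < E * d →
                  (Q + d) * (Q + d) < (1 + E) * (Q * d)
  quadratic-gap E Q@(suc _) d E>3 d<Q 2Q<Ed = ≰⇒> λ H → <-irrefl refl (cancelled H)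
    where
    t m : ℕ
    t = E * d ∸ 2 * Q
    m = E ∸ 4

    Ed≡2Q+t : E * d ≡ 2 * Q + t
    Ed≡2Q+t = sym (m+[n∸m]≡n (<⇒≤ 2Q<Ed))

    E≡4+m : E ≡ 4 + m
    E≡4+m = sym (m+[n∸m]≡n E>3)

    open ≤-Reasoning

    cancelled : (1 + E) * (Q * d) ≤ (Q + d) * (Q + d) →
                (1 + E) * (2 * Q + t) < (1 + E) * (2 * Q + t)
    cancelled H = begin-strict
      (1 + E) * (2 * Q + t)                      ≤⟨ *-cancelˡ-≤ Q scaled ⟩
      -- At E = 4 the multiples of `Q` in the final comparison agree, being 10 `Q` on both sides, so
      -- strictness is taken from `d < Q`.
      E * Q + 4 * Q + 3 * t + 2 * d              <⟨ +-monoʳ-< (E * Q + 4 * Q + 3 * t) (*-monoʳ-< 2 d<Q) ⟩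
      E * Q + 4 * Q + 3 * t + 2 * Q              ≡⟨ cong (λ e → e * Q + 4 * Q + 3 * t + 2 * Q) E≡4+m ⟩
      (4 + m) * Q + 4 * Q + 3 * t + 2 * Q        ≤⟨ m≤m+n _ (m * Q + (2 + m) * t) ⟩
      (4 + m) * Q + 4 * Q + 3 * t + 2 * Q + (m * Q + (2 + m) * t)
                                                 ≡⟨ expand m Q t ⟩
      (1 + (4 + m)) * (2 * Q + t)                ≡⟨ cong (λ e → (1 + e) * (2 * Q + t)) E≡4+m ⟨
      (1 + E) * (2 * Q + t)                      ∎
      where
      expand : ∀ m Q t → (4 + m) * Q + 4 * Q + 3 * t + 2 * Q + (m * Q + (2 + m) * t)
                       ≡ (1 + (4 + m)) * (2 * Q + t)
      expand = solve-∀

      lhs : ∀ E Q d → E * ((1 + E) * (Q * d)) ≡ Q * ((1 + E) * (E * d))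
      lhs = solve-∀

      rhs : ∀ E Q d → E * ((Q + d) * (Q + d)) ≡ E * (Q * Q) + (2 * Q + d) * (E * d)
      rhs = solve-∀

      rhs′ : ∀ E Q d t → E * (Q * Q) + (2 * Q + d) * (2 * Q + t) ≡
                         E * (Q * Q) + 4 * (Q * Q) + 2 * (Q * t) + 2 * (Q * d) + d * t
      rhs′ = solve-∀

      factor : ∀ E Q d t → E * (Q * Q) + 4 * (Q * Q) + 2 * (Q * t) + 2 * (Q * d) + Q * t ≡
                           Q * (E * Q + 4 * Q + 3 * t + 2 * d)
      factor = solve-∀

      scaled : Q * ((1 + E) * (2 * Q + t)) ≤ Q * (E * Q + 4 * Q + 3 * t + 2 * d)
      scaled = begin
        Q * ((1 + E) * (2 * Q + t))                 ≡⟨ cong (λ z → Q * ((1 + E) * z)) Ed≡2Q+t ⟨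
        Q * ((1 + E) * (E * d))                     ≡⟨ lhs E Q d ⟨
        E * ((1 + E) * (Q * d))                     ≤⟨ *-monoʳ-≤ E H ⟩
        E * ((Q + d) * (Q + d))                     ≡⟨ rhs E Q d ⟩
        E * (Q * Q) + (2 * Q + d) * (E * d)         ≡⟨ cong (λ z → E * (Q * Q) + (2 * Q + d) * z) Ed≡2Q+t ⟩
        E * (Q * Q) + (2 * Q + d) * (2 * Q + t)     ≡⟨ rhs′ E Q d t ⟩
        E * (Q * Q) + 4 * (Q * Q) + 2 * (Q * t) + 2 * (Q * d) + d * t
          ≤⟨ +-monoʳ-≤ (E * (Q * Q) + 4 * (Q * Q) + 2 * (Q * t) + 2 * (Q * d)) (*-monoˡ-≤ t (<⇒≤ d<Q)) ⟩
        E * (Q * Q) + 4 * (Q * Q) + 2 * (Q * t) + 2 * (Q * d) + Q * t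
          ≡⟨ factor E Q d t ⟩
        Q * (E * Q + 4 * Q + 3 * t + 2 * d)         ∎

  m≤m*m : ∀ m → m ≤ m * m
  m≤m*m zero      = z≤n
  m≤m*m m@(suc _) = m≤m*n m m

  ∣⇒*≤* : ∀ {d m} → d ∣ m → d * m ≤ m * m
  ∣⇒*≤* {d} {zero}  _   = ≤-reflexive (*-zeroʳ d)
  ∣⇒*≤* {d} {suc m} d∣m = *-monoˡ-≤ (suc m) (∣⇒≤ d∣m)

  -- (k - 1)(k - 1 - d) ≥ 0 for k ≡ 1 (mod d), without subtraction.
  ≡1-mod⇒secant : ∀ {d k} → d > 3 → d ∣ ∣ k - 1 ∣ → (2 + d) * k ≤ k * k + (1 + d)
  ≡1-mod⇒secant {d} {zero}  d>3 d∣1 = contradiction (∣⇒≤ d∣1) (<⇒≱ (≤-trans (s≤s (s≤s z≤n)) d>3))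
  ≡1-mod⇒secant {d} {suc m} _   d∣m = begin
    (2 + d) * suc m                ≡⟨ lhs d m ⟩
    d * m + (2 + d + 2 * m)        ≤⟨ +-monoˡ-≤ _ (∣⇒*≤* (subst (d ∣_) (∣-∣-identityʳ m) d∣m)) ⟩
    m * m + (2 + d + 2 * m)        ≡⟨ rhs d m ⟩
    suc m * suc m + (1 + d)        ∎
    where
    open ≤-Reasoning
    lhs : ∀ d m → (2 + d) * (1 + m) ≡ d * m + (2 + d + 2 * m)
    lhs = solve-∀
    rhs : ∀ d m → m * m + (2 + d + 2 * m) ≡ (1 + m) * (1 + m) + (1 + d)
    rhs = solve-∀

  -- N counts all vectors, β those spanning a point of B, and ρ the other nonzero
  -- ones.  The terms with factor β, the term q (q β) and those with factor ρ come
  -- from the pairs (u, v) with u in B, u = 0 and u outside B, respectively.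
  PairCount : (q r E N β ρ : ℕ) → Set
  PairCount q r E N β ρ =
    β * (E * (q * β) + q * (r * r)) + q * (q * β) + ρ * ((2 + E) * (q * β) + q * (1 + E)) ≤
    q * (N * β + r * (β * β)) + β * (q * (E * r)) + ρ * (N * (1 + E))

  -- To be used for q = 1 + r and x = θₙ₋₂, when Q = qⁿ⁻¹, T = θₙ₋₁, Θ = θₙ and N = qⁿ⁺¹.
  module Arithmetic (r x E b : ℕ) where
    q Q T Θ N : ℕ
    q = 1 + r
    Q = r * x + 1
    T = q * x + 1
    Θ = q * T + 1
    N = r * Θ + 1

    -- The sum of (k - 1)(k - 1 - E) ≥ 0 over all lines: each point lies on T lines, so k sums to b
    -- T and k (k - 1) sums to b (b - 1), and there are Θ T / (1 + q) lines. Everything is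
    -- multiplied by 1 + q.
    LineCount : Set
    LineCount = (1 + q) * (b + (1 + E) * (T * b)) ≤ (1 + q) * (b * b) + (1 + E) * (Θ * T)

    bound : E > 3 → T < b → b < 2 * Q → LineCount → E * b ≤ (E + 2) * Q
    bound E>3 T<b b<2Q count = ≮⇒≥ λ big →
      <⇒≱ (quadratic-gap E Q d E>3 d<Q (2Q<Ed big)) reduced
      where
      d : ℕ
      d = b ∸ Q

      T≡Q+x : ∀ r x → (1 + r) * x + 1 ≡ (r * x + 1) + x
      T≡Q+x = solve-∀

      Q+x≤b : Q + x ≤ b
      Q+x≤b = ≤-trans (≤-reflexive (sym (T≡Q+x r x))) (<⇒≤ T<b)

      b≡Q+d : b ≡ Q + d
      b≡Q+d = sym (m+[n∸m]≡n (≤-trans (m≤m+n Q x) Q+x≤b))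

      d<Q : d < Q
      d<Q = +-cancelˡ-< Q d Q (subst₂ _<_ b≡Q+d (cong (Q +_) (+-identityʳ Q)) b<2Q)

      open ≤-Reasoning

      2Q<Ed : (E + 2) * Q < E * b → 2 * Q < E * d
      2Q<Ed big = +-cancelˡ-< (E * Q) _ _ (begin-strict
        E * Q + 2 * Q  ≡⟨ *-distribʳ-+ Q E 2 ⟨
        (E + 2) * Q    <⟨ big ⟩
        E * b          ≡⟨ cong (E *_) b≡Q+d ⟩
        E * (Q + d)    ≡⟨ *-distribˡ-+ E Q d ⟩
        E * Q + E * d  ∎)

      -- The two sides differ by x² - x only. The right side is written with T x so that this term
      -- cancels in `step₂`.
      Θ-bound : Θ * T ≤ (1 + q) * (T * x + Q * Q)
      Θ-bound = +-cancelʳ-≤ x _ _ (begin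
        Θ * T + x                        ≤⟨ +-monoʳ-≤ (Θ * T) (m≤m*m x) ⟩
        Θ * T + x * x                    ≡⟨ identity r x ⟩
        (1 + q) * (T * x + Q * Q) + x    ∎)
        where
        identity : ∀ r x →
          ((1 + r) * ((1 + r) * x + 1) + 1) * ((1 + r) * x + 1) + x * x ≡
          (2 + r) * (((1 + r) * x + 1) * x + (r * x + 1) * (r * x + 1)) + x
        identity = solve-∀

      step₁ : b + (1 + E) * (T * b) ≤ b * b + (1 + E) * (T * x + Q * Q)
      step₁ = *-cancelˡ-≤ (1 + q) (begin
        (1 + q) * (b + (1 + E) * (T * b))                       ≤⟨ count ⟩
        (1 + q) * (b * b) + (1 + E) * (Θ * T)
          ≤⟨ +-monoʳ-≤ ((1 + q) * (b * b)) (*-monoʳ-≤ (1 + E) Θ-bound) ⟩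
        (1 + q) * (b * b) + (1 + E) * ((1 + q) * (T * x + Q * Q)) ≡⟨ identity (1 + q) (1 + E) (b * b) (T * x + Q * Q) ⟩
        (1 + q) * (b * b + (1 + E) * (T * x + Q * Q))           ∎)
        where
        identity : ∀ a e y z → a * y + e * (a * z) ≡ a * (y + e * z)
        identity = solve-∀

      step₂ : (1 + E) * (Q * b) ≤ b * b + (1 + E) * (Q * Q)
      step₂ = +-cancelʳ-≤ ((1 + E) * (T * x)) _ _ (begin
        -- As T = Q + x, the product T b is Q b + x b, and T < b gives x b ≥ T x. This removes `x`
        -- and leaves an inequality in `Q` and `b`.
        (1 + E) * (Q * b) + (1 + E) * (T * x)          ≤⟨ +-monoʳ-≤ ((1 + E) * (Q * b)) (*-monoʳ-≤ (1 + E) (*-monoˡ-≤ x (<⇒≤ T<b))) ⟩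
        (1 + E) * (Q * b) + (1 + E) * (b * x)          ≡⟨ identity (1 + E) Q b x ⟩
        (1 + E) * ((Q + x) * b)                        ≡⟨ cong (λ z → (1 + E) * (z * b)) (T≡Q+x r x) ⟨
        (1 + E) * (T * b)                              ≤⟨ m≤n+m _ b ⟩
        b + (1 + E) * (T * b)                          ≤⟨ step₁ ⟩
        b * b + (1 + E) * (T * x + Q * Q)              ≡⟨ identity′ (1 + E) (b * b) (T * x) (Q * Q) ⟩
        b * b + (1 + E) * (Q * Q) + (1 + E) * (T * x)  ∎)
        where
        identity : ∀ e Q b x → e * (Q * b) + e * (b * x) ≡ e * ((Q + x) * b)
        identity = solve-∀

        identity′ : ∀ e y z w → y + e * (z + w) ≡ y + e * w + e * z
        identity′ = solve-∀

      reduced : (1 + E) * (Q * d) ≤ (Q + d) * (Q + d)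
      reduced = +-cancelʳ-≤ ((1 + E) * (Q * Q)) _ _ (begin
        (1 + E) * (Q * d) + (1 + E) * (Q * Q)       ≡⟨ identity (1 + E) Q d ⟩
        (1 + E) * (Q * (Q + d))                     ≡⟨ cong (λ z → (1 + E) * (Q * z)) b≡Q+d ⟨
        (1 + E) * (Q * b)                           ≤⟨ step₂ ⟩
        b * b + (1 + E) * (Q * Q)                   ≡⟨ cong (λ z → z * z + (1 + E) * (Q * Q)) b≡Q+d ⟩
        (Q + d) * (Q + d) + (1 + E) * (Q * Q)       ∎)
        where
        identity : ∀ e Q d → e * (Q * d) + e * (Q * Q) ≡ e * (Q * (Q + d))
        identity = solve-∀

    β : ℕ
    β = r * b

    -- Adding β (c₁ + c₂) to both sides makes ρ occur only in ρ + β = r Θ; what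
    -- remains is LineCount multiplied by q r², up to common terms.
    pairCount⇒lineCount : ∀ ρ → .{{NonZero r}} → ρ + β + 1 ≡ N → PairCount q r E N β ρ → LineCount
    pairCount⇒lineCount ρ total count = *-cancelˡ-≤ (q * r * r) {{m*n≢0 (q * r) r {{m*n≢0 q r}}}}
      (+-cancelˡ-≤ X _ _ (begin
        X + q * r * r * ((1 + q) * (b + (1 + E) * (T * b)))
          ≤⟨ +-monoˡ-≤ _ cleared ⟩
        Y + q * r * r * ((1 + q) * (b + (1 + E) * (T * b)))
          ≡⟨ identity r x E b ⟨
        X + q * r * r * ((1 + q) * (b * b) + (1 + E) * (Θ * T)) ∎))
      where
      open ≤-Reasoning
      c₁ c₂ X Y : ℕ
      c₁ = (2 + E) * (q * β) + q * (1 + E)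
      c₂ = N * (1 + E)
      X = β * (E * (q * β) + q * (r * r)) + q * (q * β) + r * Θ * c₁ + β * c₂
      Y = q * (N * β + r * (β * β)) + β * (q * (E * r)) + r * Θ * c₂ + β * c₁

      ρ+β : ρ + β ≡ r * Θ
      ρ+β = +-cancelʳ-≡ 1 _ _ total

      cleared : X ≤ Y
      cleared = begin
        X ≡⟨ cong (λ z → L + z * c₁ + β * c₂) ρ+β ⟨
        L + (ρ + β) * c₁ + β * c₂ ≡⟨ shuffle L ρ β c₁ c₂ ⟩
        L + ρ * c₁ + β * (c₁ + c₂) ≤⟨ +-monoˡ-≤ _ count ⟩
        R + ρ * c₂ + β * (c₁ + c₂) ≡⟨ cong (λ z → R + ρ * c₂ + β * z) (+-comm c₁ c₂) ⟩
        R + ρ * c₂ + β * (c₂ + c₁) ≡⟨ shuffle R ρ β c₂ c₁ ⟨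
        R + (ρ + β) * c₂ + β * c₁ ≡⟨ cong (λ z → R + z * c₂ + β * c₁) ρ+β ⟩
        Y ∎
        where
        L R : ℕ
        L = β * (E * (q * β) + q * (r * r)) + q * (q * β)
        R = q * (N * β + r * (β * β)) + β * (q * (E * r))
        shuffle : ∀ L ρ β c₁ c₂ → L + (ρ + β) * c₁ + β * c₂ ≡ L + ρ * c₁ + β * (c₁ + c₂)
        shuffle = solve-∀

      identity : ∀ r x E b →
        let q = 1 + r
            T = q * x + 1
            Θ = q * T + 1
            N = r * Θ + 1
            β = r * b
            c₁ = (2 + E) * (q * β) + q * (1 + E)
            c₂ = N * (1 + E)
        in
        β * (E * (q * β) + q * (r * r)) + q * (q * β) + r * Θ * c₁ + β * c₂
          + q * r * r * ((1 + q) * (b * b) + (1 + E) * (Θ * T)) ≡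
        q * (N * β + r * (β * β)) + β * (q * (E * r)) + r * Θ * c₂ + β * c₁
          + q * r * r * ((1 + q) * (b + (1 + E) * (T * b)))
      identity = solve-∀

  -- This is θ with its index shifted by one, so that the empty sum is included. The Horner form
  -- makes successive values agree by computation with `x`, `T` and `Θ` above.
  geometric : ℕ → ℕ → ℕ
  geometric r zero    = 0
  geometric r (suc m) = (1 + r) * geometric r m + 1

  ^-geometric : ∀ r m → (1 + r) ^ m ≡ r * geometric r m + 1
  ^-geometric r zero    = cong (_+ 1) (sym (*-zeroʳ r))
  ^-geometric r (suc m) = trans (cong ((1 + r) *_) (^-geometric r m)) (identity r (geometric r m))
    where
    identity : ∀ r x → (1 + r) * (r * x + 1) ≡ r * ((1 + r) * x + 1) + 1
    identity = solve-∀

  θ-geometric : ∀ r m .{{_ : NonZero r}} .{{_ : NonTrivial (suc r)}} → θ (suc r) m ≡ geometric r (suc m)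
  θ-geometric r@(suc _) m = begin
    (suc r ^ (m + 1) ∸ 1) / r              ≡⟨ cong (λ k → (suc r ^ k ∸ 1) / r) (+-comm m 1) ⟩
    (suc r ^ suc m ∸ 1) / r                ≡⟨ cong (λ k → (k ∸ 1) / r) (^-geometric r (suc m)) ⟩
    (r * geometric r (suc m) + 1 ∸ 1) / r  ≡⟨ cong (_/ r) (m+n∸n≡m (r * geometric r (suc m)) 1) ⟩
    r * geometric r (suc m) / r            ≡⟨ cong (_/ r) (*-comm r (geometric r (suc m))) ⟩
    geometric r (suc m) * r / r            ≡⟨ m*n/n≡m (geometric r (suc m)) r ⟩
    geometric r (suc m)                    ∎
    where open ≡-Reasoning

open Inequalities

-- Clearing denominators in the final inequality.

module Rationals where

  open import Data.Nat.Base
  open import Data.Nat.Properties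
  open ℤ using (+_; +≤+)
  open ≡ using (trans; cong; cong₂; subst₂)

  -- Fractions in `ℚ` are reduced by a gcd, which is stuck on variables. In `ℚᵘ` the comparison is
  -- plain cross-multiplication.
  *≤⇒/≤ : ∀ E .{{_ : NonZero E}} b Q → E * b ≤ (E + 2) * Q →
          (+ b) ℚ./ 1 ℚ.≤ (+ Q) ℚ./ 1 ℚ.+ (+ (2 * Q)) ℚ./ E
  *≤⇒/≤ E@(suc e) b Q Eb≤[E+2]Q = ℚ.toℚᵘ-cancel-≤ (begin
    ℚ.toℚᵘ ((+ b) ℚ./ 1)                                      ≃⟨ ℚ.toℚᵘ-fromℚᵘ (mkℚᵘ (+ b) 0) ⟩
    mkℚᵘ (+ b) 0                                              ≤⟨ *≤* cross ⟩
    mkℚᵘ (+ Q) 0 ℚᵘ.+ mkℚᵘ (+ (2 * Q)) e                      ≃⟨ ℚᵘ.+-cong (ℚ.toℚᵘ-fromℚᵘ (mkℚᵘ (+ Q) 0)) (ℚ.toℚᵘ-fromℚᵘ (mkℚᵘ (+ (2 * Q)) e)) ⟨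
    ℚ.toℚᵘ ((+ Q) ℚ./ 1) ℚᵘ.+ ℚ.toℚᵘ ((+ (2 * Q)) ℚ./ E)      ≃⟨ ℚ.toℚᵘ-homo-+ ((+ Q) ℚ./ 1) ((+ (2 * Q)) ℚ./ E) ⟨
    ℚ.toℚᵘ ((+ Q) ℚ./ 1 ℚ.+ (+ (2 * Q)) ℚ./ E)                ∎)
    where
    open ℚᵘ.≤-Reasoning
    lhs : ∀ E b → b * (1 * E) ≡ E * b
    lhs = solve-∀

    rhs : ∀ E Q → (E + 2) * Q ≡ (Q * E + 2 * Q * 1) * 1
    rhs = solve-∀

    cross : + b ℤ.* + (1 * E) ℤ.≤ (+ Q ℤ.* + E ℤ.+ + (2 * Q) ℤ.* + 1) ℤ.* + 1
    cross = subst₂ ℤ._≤_ (ℤₚ.pos-* b (1 * E))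
      (trans (ℤₚ.pos-* (Q * E + 2 * Q * 1) 1)
        (cong (ℤ._* + 1) (trans (ℤₚ.pos-+ (Q * E) (2 * Q * 1)) (cong₂ ℤ._+_ (ℤₚ.pos-* Q E) (ℤₚ.pos-* (2 * Q) 1)))))
      (+≤+ (≤-trans (≤-reflexive (lhs E b)) (≤-trans Eb≤[E+2]Q (≤-reflexive (rhs E Q)))))

open Rationals

-- Indicators and sums over finite setoids.

module FiniteSums where

  open import Data.Nat.Base
  open import Data.Nat.Properties
  open ≡ using (refl; sym; trans; cong; cong₂; subst; module ≡-Reasoning)

  private
    module Sum = SemiringSum +-*-semiring

    variable
      a p ℓ ℓ′ : Level

  -- 𝟙 and ∑ are opaque so that a summand can be inferred from its sum.
  opaque

    𝟙 : {P : Set p} → Dec P → ℕ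
    𝟙 P? = if does P? then 1 else 0

    𝟙-true : {P : Set p} (P? : Dec P) → P → 𝟙 P? ≡ 1
    𝟙-true (yes _) _  = refl
    𝟙-true (no ¬p) pp = contradiction pp ¬p

    𝟙-false : {P : Set p} (P? : Dec P) → ¬ P → 𝟙 P? ≡ 0
    𝟙-false (yes pp) ¬p = contradiction pp ¬p
    𝟙-false (no _)   _  = refl

    𝟙-idem : {P : Set p} (P? : Dec P) → 𝟙 P? * 𝟙 P? ≡ 𝟙 P?
    𝟙-idem (yes _) = refl
    𝟙-idem (no _)  = refl

    𝟙-cong : {P : Set p} {Q : Set ℓ} (P? : Dec P) (Q? : Dec Q) → (P → Q) → (Q → P) → 𝟙 P? ≡ 𝟙 Q?
    𝟙-cong P? (yes q) _   Q⇒P = 𝟙-true P? (Q⇒P q)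
    𝟙-cong P? (no ¬q) P⇒Q _   = 𝟙-false P? (¬q ∘ P⇒Q)

    𝟙-complement : {P : Set p} {Q : Set ℓ} (P? : Dec P) (Q? : Dec Q) → (P → ¬ Q) → (¬ P → Q) → 𝟙 P? + 𝟙 Q? ≡ 1
    𝟙-complement (yes pp) Q? P⇒¬Q _   = cong (1 +_) (𝟙-false Q? (P⇒¬Q pp))
    𝟙-complement (no ¬p)  Q? _   ¬P⇒Q = 𝟙-true Q? (¬P⇒Q ¬p)

  sum-mono-≤ : ∀ {k} {f g : Fin k → ℕ} → (∀ i → f i ≤ g i) → Sum.sum f ≤ Sum.sum g
  sum-mono-≤ {zero}  f≤g = z≤n
  sum-mono-≤ {suc k} f≤g = +-mono-≤ (f≤g zero) (sum-mono-≤ (f≤g ∘ suc))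

  opaque
    unfolding 𝟙

    -- At most one summand is 1, so the sum is itself an indicator. `Q` may be any description of
    -- when a witness exists; this is the tool behind every double count below.
    sum-unique : ∀ {k} {P : Pred (Fin k) p} {Q : Set ℓ} (P? : Decidable P) (Q? : Dec Q) →
                 (Q → ∃ P) → (∀ {i} → P i → Q) → (∀ {i j} → P i → P j → i ≡ j) →
                 Sum.sum (𝟙 ∘ P?) ≡ 𝟙 Q?
    sum-unique {k = zero} P? Q? Q⇒∃P _ _ = sym (𝟙-false Q? λ q → Fin.¬Fin0 (proj₁ (Q⇒∃P q)))
    sum-unique {k = suc k} {P = P} P? Q? Q⇒∃P P⇒Q unique with P? zero
    ... | yes p₀ = begin
      1 + Sum.sum (𝟙 ∘ P? ∘ suc)     ≡⟨ cong (1 +_) (Sum.sum-cong-≗ λ i → 𝟙-false (P? (suc i)) λ pᵢ → contradiction (unique p₀ pᵢ) λ ()) ⟩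
      1 + Sum.sum {k} (λ _ → 0)      ≡⟨ cong (1 +_) (Sum.sum-replicate-zero k) ⟩
      1                              ≡⟨ 𝟙-true Q? (P⇒Q p₀) ⟨
      𝟙 Q?                           ∎
      where open ≡-Reasoning
    ... | no ¬p₀ = sum-unique (P? ∘ suc) Q? (nonzero ∘ Q⇒∃P) P⇒Q λ pᵢ pⱼ → Fin.suc-injective (unique pᵢ pⱼ)
      where
      nonzero : ∃ P → ∃ (P ∘ suc)
      nonzero (zero  , p₀) = contradiction p₀ ¬p₀
      nonzero (suc i , pᵢ) = i , pᵢ

  module _ {S : Setoid a ℓ} {k : ℕ} (size : HasSize S k) where

    open Setoid S using (Carrier; _≈_) renaming (refl to ≈-refl; sym to ≈-sym; trans to ≈-trans)
    open Bijection size using (to; to⁻; injective; surjective)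

    private
      to-to⁻ : ∀ x → to (to⁻ x) ≈ x
      to-to⁻ x = proj₂ (surjective x) refl

      to⁻-to : ∀ {i x} → to i ≈ x → to⁻ x ≡ i
      to⁻-to eq = injective (≈-trans (to-to⁻ _) (≈-sym eq))

      to⁻-cong : ∀ {x y} → x ≈ y → to⁻ x ≡ to⁻ y
      to⁻-cong x≈y = to⁻-to (≈-trans (to-to⁻ _) (≈-sym x≈y))

    opaque

      ≈-dec : Decidable₂ _≈_
      ≈-dec x y = map′ (λ eq → ≈-trans (≈-sym (to-to⁻ x)) (subst (λ i → to i ≈ y) (sym eq) (to-to⁻ y)))
                       to⁻-cong (to⁻ x Fin.≟ to⁻ y)

      ∃-dec : {P : Pred Carrier p} → P Respects _≈_ → Decidable P → Dec (∃ P)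
      ∃-dec resp P? = map′ (λ (i , pᵢ) → to i , pᵢ)
                           (λ (x , pₓ) → to⁻ x , resp (≈-sym (to-to⁻ x)) pₓ)
                           (Fin.any? (P? ∘ to))

      ∑ : (Carrier → ℕ) → ℕ
      ∑ f = Sum.sum (f ∘ to)

      ∑-cong : ∀ {f g} → (∀ x → f x ≡ g x) → ∑ f ≡ ∑ g
      ∑-cong f≗g = Sum.sum-cong-≗ (f≗g ∘ to)

      ∑-mono-≤ : ∀ {f g} → (∀ x → f x ≤ g x) → ∑ f ≤ ∑ g
      ∑-mono-≤ f≤g = sum-mono-≤ (f≤g ∘ to)

      ∑-+ : ∀ f g → ∑ (λ x → f x + g x) ≡ ∑ f + ∑ g
      ∑-+ f g = Sum.∑-distrib-+ (f ∘ to) (g ∘ to)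

      ∑-*ˡ : ∀ m f → ∑ (λ x → m * f x) ≡ m * ∑ f
      ∑-*ˡ m f = sym (Sum.*-distribˡ-sum m (f ∘ to))

      ∑-*ʳ : ∀ m f → ∑ (λ x → f x * m) ≡ ∑ f * m
      ∑-*ʳ m f = sym (Sum.*-distribʳ-sum m (f ∘ to))

      ∑-const : ∀ m → ∑ (λ _ → m) ≡ k * m
      ∑-const m = trans (Sum.sum-replicate k) (⋆≡* k)
        where
        open RawMonoid +-0-rawMonoid using () renaming (_×_ to _⋆_)

        ⋆≡* : ∀ k → k ⋆ m ≡ k * m
        ⋆≡* zero    = refl
        ⋆≡* (suc k) = cong (m +_) (⋆≡* k)

      -- Conjugating `g` with the enumeration gives a permutation of the indices. As `to ∘ to⁻` is
      -- the identity only up to `_≈_`, the summand has to respect `_≈_`.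
      ∑-reindex : ∀ {f} → f Preserves _≈_ ⟶ _≡_ → ∀ g g⁻¹ →
                  g Preserves _≈_ ⟶ _≈_ → g⁻¹ Preserves _≈_ ⟶ _≈_ →
                  (∀ x → g (g⁻¹ x) ≈ x) → (∀ x → g⁻¹ (g x) ≈ x) →
                  ∑ (f ∘ g) ≡ ∑ f
      ∑-reindex {f} f-cong g g⁻¹ g-cong g⁻¹-cong gg⁻¹ g⁻¹g = sym (begin
        Sum.sum (f ∘ to)                   ≡⟨ Sum.sum-permute (f ∘ to) π ⟩
        Sum.sum (f ∘ to ∘ to⁻ ∘ g ∘ to)    ≡⟨ Sum.sum-cong-≗ (λ i → f-cong (to-to⁻ (g (to i)))) ⟩
        Sum.sum (f ∘ g ∘ to)               ∎)
        where
        open ≡-Reasoning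
        π : Perm.Permutation k k
        π = Perm.permutation (to⁻ ∘ g ∘ to) (to⁻ ∘ g⁻¹ ∘ to)
          (λ i → to⁻-to (≈-sym (≈-trans (g-cong (to-to⁻ _)) (gg⁻¹ _))))
          (λ i → to⁻-to (≈-sym (≈-trans (g⁻¹-cong (to-to⁻ _)) (g⁻¹g _))))

      ∑-unique : {P : Pred Carrier p} {Q : Set ℓ′} → P Respects _≈_ → (P? : Decidable P) (Q? : Dec Q) →
                 (Q → ∃ P) → (∀ {x} → P x → Q) → (∀ {x y} → P x → P y → x ≈ y) →
                 ∑ (λ x → 𝟙 (P? x)) ≡ 𝟙 Q?
      ∑-unique resp P? Q? Q⇒∃P P⇒Q unique =
        sum-unique (P? ∘ to) Q?
          (λ q → let (x , pₓ) = Q⇒∃P q in to⁻ x , resp (≈-sym (to-to⁻ x)) pₓ)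
          P⇒Q
          (λ pᵢ pⱼ → injective (unique pᵢ pⱼ))

    ∑-∃! : {P : Pred Carrier p} → P Respects _≈_ → (P? : Decidable P) →
           ∃ P → (∀ {x y} → P x → P y → x ≈ y) → ∑ (λ x → 𝟙 (P? x)) ≡ 1
    ∑-∃! resp P? ∃P unique =
      trans (∑-unique resp P? (yes tt) (λ _ → ∃P) (λ _ → tt) unique) (𝟙-true (yes tt) tt)

  opaque
    unfolding ∑

    ∑-swap : ∀ {b ℓ₂ m n} {S : Setoid a ℓ} {T : Setoid b ℓ₂} (s : HasSize S m) (t : HasSize T n)
             (f : Setoid.Carrier S → Setoid.Carrier T → ℕ) →
             ∑ s (λ x → ∑ t (f x)) ≡ ∑ t (λ y → ∑ s (λ x → f x y))
    ∑-swap s t f = Sum.∑-comm (λ i j → f (Bijection.to s i) (Bijection.to t j))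

  vectorSize : ∀ {S : Setoid a ℓ} {q} → HasSize S q → ∀ n → HasSize (VectorEquality.≋-setoid S n) (q ^ n)
  vectorSize {S = S} {q} size n = record
    { to        = λ i k → to (finToFun i k)
    ; cong      = λ { refl k → ≈-refl }
    ; bijective = inj , λ v → funToFin (to⁻ ∘ v) ,
        λ { refl k → ≈-trans (reflexive (cong to (Fin.finToFun-funToFin (to⁻ ∘ v) k)))
                             (proj₂ (surjective (v k)) refl) }
    }
    where
    open Bijection size using (to; to⁻; injective; surjective)
    open Setoid S using (reflexive; _≈_) renaming (refl to ≈-refl; trans to ≈-trans)

    funToFin-cong : ∀ {n} {f g : Fin n → Fin q} → (∀ k → f k ≡ g k) → funToFin f ≡ funToFin g
    funToFin-cong {zero}  f≗g = refl
    funToFin-cong {suc n} f≗g = cong₂ combine (f≗g zero) (funToFin-cong (f≗g ∘ suc))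

    inj : ∀ {i j : Fin (q ^ n)} → (∀ k → to (finToFun i k) ≈ to (finToFun j k)) → i ≡ j
    inj {i} {j} eq = begin
      i                                ≡⟨ Fin.funToFin-finToFin {n} i ⟨
      funToFin (finToFun {q} {n} i)    ≡⟨ funToFin-cong (λ k → injective (eq k)) ⟩
      funToFin (finToFun {q} {n} j)    ≡⟨ Fin.funToFin-finToFin {n} j ⟩
      j                                ∎
      where open ≡-Reasoning

open FiniteSums

-- Decidability and counting in a finite Heyting field.

module FiniteField {c ℓ₁ ℓ₂} (F : HeytingField c ℓ₁ ℓ₂) {q} (size : HasSize (HeytingField.setoid F) q) where

  open HeytingField F
  open HeytingProperties heytingCommutativeRing

  open CommutativeRing (HeytingCommutativeRing.commutativeRing heytingCommutativeRing) public using (ring; +-commutativeSemigroup; *-commutativeSemigroup)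
  open RingProperties ring public using (x∙y⁻¹≈ε⇒x≈y; //-rightDividesˡ; //-rightDividesʳ; +-cancelʳ; [y-z]x≈yx-zx)
  module +-Props = CommutativeSemigroupProperties +-commutativeSemigroup
  module *-Props = CommutativeSemigroupProperties *-commutativeSemigroup

  infix 4 _≟_
  _≟_ : ∀ x y → Dec (x ≈ y)
  _≟_ = ≈-dec size

  inverse : ∀ {x} → x # 0# → ∃ λ y → y * x ≈ 1#
  inverse x#0 with #⇒invertible x#0
  ... | y , y[x-0]≈1 , _ = y , trans (*-congˡ (sym (x-0≈x _))) y[x-0]≈1

  unit⇒#0 : ∀ {x y} → y * x ≈ 1# → x # 0#
  unit⇒#0 {x} {y} yx≈1 = invertibleˡ⇒# (y , trans (*-congˡ (x-0≈x x)) yx≈1)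

  -- Being apart from 0 means being invertible, and an inverse can be searched for among the q
  -- elements.
  #0? : ∀ x → Dec (x # 0#)
  #0? x = map′ (λ (_ , yx≈1) → unit⇒#0 yx≈1) inverse
            (∃-dec size (λ y≈z yx≈1 → trans (*-congʳ (sym y≈z)) yx≈1) λ y → (y * x) ≟ 1#)

  #0-resp : ∀ {x y} → x ≈ y → x # 0# → y # 0#
  #0-resp = #-congʳ

  ¬#0⇒≈0 : ∀ {x} → ¬ x # 0# → x ≈ 0#
  ¬#0⇒≈0 = proj₁ (tight _ _)

  ≈0⇒¬#0 : ∀ {x} → x ≈ 0# → ¬ x # 0#
  ≈0⇒¬#0 = proj₂ (tight _ _)

  exchange : ∀ {w x y z} → x + y ≈ z + w → y - w ≈ z - x
  exchange {w} {x} {y} {z} x+y≈z+w = begin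
    y - w                ≈⟨ +-congʳ (//-rightDividesʳ x y) ⟨
    ((y + x) - x) - w    ≈⟨ +-congʳ (+-congʳ (trans (+-comm y x) x+y≈z+w)) ⟩
    ((z + w) - x) - w    ≈⟨ +-congʳ (+-Props.xy∙z≈xz∙y z w (- x)) ⟩
    ((z - x) + w) - w    ≈⟨ //-rightDividesʳ w (z - x) ⟩
    z - x                ∎
    where open SetoidReasoning setoid

  *-cancelʳ : ∀ {x y z} → z # 0# → x * z ≈ y * z → x ≈ y
  *-cancelʳ {x} {y} {z} z#0 xz≈yz with inverse z#0
  ... | w , wz≈1 = trans (expand x) (trans (*-congˡ xz≈yz) (sym (expand y)))
    where
    expand : ∀ x → x ≈ w * (x * z)
    expand x = sym (trans (*-Props.x∙yz≈y∙xz w x z)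
                          (trans (*-congˡ wz≈1) (*-identityʳ x)))

  𝟙#0+𝟙≈0 : ∀ x → 𝟙 (#0? x) ℕ.+ 𝟙 (x ≟ 0#) ≡ 1
  𝟙#0+𝟙≈0 x = 𝟙-complement (#0? x) (x ≟ 0#) (λ x#0 x≈0 → ≈0⇒¬#0 x≈0 x#0) ¬#0⇒≈0

  ∑≈0 : ∑ size (λ x → 𝟙 (x ≟ 0#)) ≡ 1
  ∑≈0 = ∑-∃! size (λ x≈y x≈0 → trans (sym x≈y) x≈0) (_≟ 0#) (0# , refl)
          (λ x≈0 y≈0 → trans x≈0 (sym y≈0))

  ∑#0 : ∀ {r} → q ≡ 1 ℕ.+ r → ∑ size (𝟙 ∘ #0?) ≡ r
  ∑#0 {r} q≡1+r = ℕ.+-cancelʳ-≡ 1 _ _ (begin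
    ∑ size (𝟙 ∘ #0?) ℕ.+ 1                                ≡⟨ ≡.cong (∑ size (𝟙 ∘ #0?) ℕ.+_) ∑≈0 ⟨
    ∑ size (𝟙 ∘ #0?) ℕ.+ ∑ size (λ x → 𝟙 (x ≟ 0#))        ≡⟨ ∑-+ size _ _ ⟨
    ∑ size (λ x → 𝟙 (#0? x) ℕ.+ 𝟙 (x ≟ 0#))               ≡⟨ ∑-cong size 𝟙#0+𝟙≈0 ⟩
    ∑ size (λ _ → 1)                                       ≡⟨ ∑-const size 1 ⟩
    q ℕ.* 1                                                ≡⟨ ℕ.*-identityʳ q ⟩
    q                                                      ≡⟨ q≡1+r ⟩
    1 ℕ.+ r                                                ≡⟨ ℕ.+-comm 1 r ⟩
    r ℕ.+ 1                                                ∎)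
    where open ≡.≡-Reasoning

-- Vectors, spans and the cones over point sets.

module Geometry {c ℓ₁ ℓ₂} (F : HeytingField c ℓ₁ ℓ₂) {q} (size : HasSize (HeytingField.setoid F) q) (n : ℕ) where

  open HeytingField F
  open HeytingProperties heytingCommutativeRing using (x#0y#0→xy#0; 1#0)
  open FiniteField F size
  open PG F n

  V : Set c
  V = Vector Carrier (suc n)

  V-setoid : Setoid c ℓ₁
  V-setoid = VectorEquality.≋-setoid setoid (suc n)

  open Setoid V-setoid using () renaming (_≈_ to _≋_; refl to ≋-refl; sym to ≋-sym; trans to ≋-trans)

  V-size : HasSize V-setoid (q ℕ.^ suc n)
  V-size = vectorSize size (suc n)

  infixl 6 _+ᵥ_
  infixr 7 _·_

  _+ᵥ_ : V → V → V
  (v +ᵥ w) i = v i + w i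

  _·_ : Carrier → V → V
  (a · v) i = a * v i

  Nonzero : Pred V ℓ₂
  Nonzero v = ∃ λ i → v i # 0#

  Nonzero? : Decidable Nonzero
  Nonzero? v = Fin.any? (#0? ∘ v)

  Zero : Pred V ℓ₁
  Zero v = ∀ i → v i ≈ 0#

  Zero? : Decidable Zero
  Zero? v = Fin.all? λ i → v i ≟ 0#

  ¬Nonzero⇒Zero : ∀ {v} → ¬ Nonzero v → Zero v
  ¬Nonzero⇒Zero ¬nz i = ¬#0⇒≈0 λ vᵢ#0 → ¬nz (i , vᵢ#0)

  Zero⇒¬Nonzero : ∀ {v} → Zero v → ¬ Nonzero v
  Zero⇒¬Nonzero z (i , vᵢ#0) = ≈0⇒¬#0 (z i) vᵢ#0

  infix 4 _∈⟨_⟩ _∈⟨_⟩? _∼_ _∼?_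

  _∈⟨_⟩ : V → V → Set (c ⊔ ℓ₁)
  v ∈⟨ u ⟩ = ∃ λ a → v ≋ a · u

  _∈⟨_⟩? : ∀ v u → Dec (v ∈⟨ u ⟩)
  v ∈⟨ u ⟩? = ∃-dec size (λ a≈b v≋au i → trans (v≋au i) (*-congʳ a≈b))
                         (λ a → Fin.all? λ i → v i ≟ a * u i)

  _∼_ : V → V → Set (c ⊔ ℓ₁ ⊔ ℓ₂)
  v ∼ w = ∃ λ a → a # 0# × v ≋ a · w

  multiple? : ∀ v w a → Dec (a # 0# × v ≋ a · w)
  multiple? v w a = #0? a ×-dec Fin.all? λ i → v i ≟ a * w i

  multiple-resp : ∀ {v w} → (λ a → a # 0# × v ≋ a · w) Respects _≈_
  multiple-resp a≈b (a#0 , v≋aw) = #0-resp a≈b a#0 , λ i → trans (v≋aw i) (*-congʳ a≈b)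

  _∼?_ : ∀ v w → Dec (v ∼ w)
  v ∼? w = ∃-dec size multiple-resp (multiple? v w)

  ∼-nonzero : ∀ {v w} → v ∼ w → Nonzero w → Nonzero v
  ∼-nonzero (a , a#0 , v≋aw) (i , wᵢ#0) = i , #0-resp (sym (v≋aw i)) (x#0y#0→xy#0 a#0 wᵢ#0)

  ≋⇒∼ : ∀ {v w} → v ≋ w → v ∼ w
  ≋⇒∼ v≋w = 1# , 1#0 , λ i → trans (v≋w i) (sym (*-identityˡ _))

  private module P = Setoid pointSetoid

  Cone : ∀ {s} → Pred Point s → Pred V (ℓ₂ ⊔ s)
  Cone A v = Σ (Nonzero v) λ nz → A (v , nz)

  module _ {s} {A : Pred Point s} (A-resp : A Respects _≈ₚ_) where

    Cone-resp-∼ : ∀ {v w} → w ∼ v → Cone A v → Cone A w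
    Cone-resp-∼ {v} {w} w∼v (nz , v∈A) = nz′ , A-resp (P.sym {w , nz′} {v , nz} w∼v) v∈A
      where nz′ = ∼-nonzero w∼v nz

    -- The enumeration `card` lists each point of `A` once up to proportionality, so `v` is
    -- proportional to one listed representative or to none. This converts counts of points into
    -- sums over vectors, both for B and for its intersection with a line.
    𝟙-cone : ∀ {k ℓ} (card : Card A k) v {Q : Set ℓ} (Q? : Dec Q) → (Q → Cone A v) → (Cone A v → Q) →
             ∑ card (λ Y → 𝟙 (v ∼? proj₁ (proj₁ Y))) ≡ 𝟙 Q?
    𝟙-cone card v Q? Q⇒A A⇒Q = ∑-unique card
      (λ {Y} {Z} Y≈Z v∼Y → P.trans {v , ∼-nonzero v∼Y (proj₂ (proj₁ Y))} {proj₁ Y} {proj₁ Z} v∼Y Y≈Z)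
      (λ Y → v ∼? proj₁ (proj₁ Y)) Q?
      (λ q → let (nz , v∈A) = Q⇒A q in ((v , nz) , v∈A) , P.refl {v , nz})
      (λ {((y , nz) , y∈A)} v∼y → A⇒Q (Cone-resp-∼ v∼y (nz , y∈A)))
      (λ {Y} {Z} v∼Y v∼Z → let v′ = v , ∼-nonzero v∼Y (proj₂ (proj₁ Y)) in
        P.trans {proj₁ Y} {v′} {proj₁ Z} (P.sym {v′} {proj₁ Y} v∼Y) v∼Z)

  ∑-≋ : ∀ w → ∑ V-size (λ v → 𝟙 (Fin.all? λ i → v i ≟ w i)) ≡ 1
  ∑-≋ w = ∑-∃! V-size (λ v≋v′ v≋w → ≋-trans (≋-sym v≋v′) v≋w) (λ v → Fin.all? λ i → v i ≟ w i)
    (w , ≋-refl) (λ v≋w v′≋w → ≋-trans v≋w (≋-sym v′≋w))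

  ·-cancelʳ : ∀ {u a b} → Nonzero u → a · u ≋ b · u → a ≈ b
  ·-cancelʳ (i , uᵢ#0) au≋bu = *-cancelʳ uᵢ#0 (au≋bu i)

  -- Counts the pairs (v, a) with v = a w and a nonzero in two ways: `v` determines `a` because `w`
  -- is nonzero, and `a` determines `v`.
  ∑-∼ : ∀ {r} → q ≡ 1 ℕ.+ r → ∀ {w} → Nonzero w → ∑ V-size (λ v → 𝟙 (v ∼? w)) ≡ r
  ∑-∼ {r} q≡1+r {w} nz = begin
    ∑ V-size (λ v → 𝟙 (v ∼? w))
      ≡⟨ ∑-cong V-size (λ v → ∑-unique size multiple-resp (multiple? v w) (v ∼? w) (λ p → p) (λ {a} p → a , p)
           λ (_ , v≋aw) (_ , v≋bw) → ·-cancelʳ nz (≋-trans (≋-sym v≋aw) v≋bw)) ⟨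
    ∑ V-size (λ v → ∑ size λ a → 𝟙 (multiple? v w a))
      ≡⟨ ∑-swap V-size size _ ⟩
    ∑ size (λ a → ∑ V-size λ v → 𝟙 (multiple? v w a))
      ≡⟨ ∑-cong size (λ a → ∑-unique V-size (λ v≋v′ (a#0 , v≋aw) → a#0 , ≋-trans (≋-sym v≋v′) v≋aw)
           (λ v → multiple? v w a) (#0? a) (λ a#0 → a · w , a#0 , ≋-refl) proj₁
           λ (_ , v≋aw) (_ , v′≋aw) → ≋-trans v≋aw (≋-sym v′≋aw)) ⟩
    ∑ size (𝟙 ∘ #0?)
      ≡⟨ ∑#0 q≡1+r ⟩
    r ∎
    where open ≡.≡-Reasoning

  ∑-∈⟨⟩ : ∀ {u} → Nonzero u → ∑ V-size (λ v → 𝟙 (v ∈⟨ u ⟩?)) ≡ q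
  ∑-∈⟨⟩ {u} nz = begin
    ∑ V-size (λ v → 𝟙 (v ∈⟨ u ⟩?))
      ≡⟨ ∑-cong V-size (λ v → ∑-unique size (λ a≈b v≋au i → trans (v≋au i) (*-congʳ a≈b))
           (λ a → Fin.all? λ i → v i ≟ a * u i) (v ∈⟨ u ⟩?) (λ p → p) (λ {a} p → a , p)
           λ v≋au v≋bu → ·-cancelʳ nz (≋-trans (≋-sym v≋au) v≋bu)) ⟨
    ∑ V-size (λ v → ∑ size λ a → 𝟙 (Fin.all? λ i → v i ≟ a * u i))
      ≡⟨ ∑-swap V-size size _ ⟩
    ∑ size (λ a → ∑ V-size λ v → 𝟙 (Fin.all? λ i → v i ≟ a * u i))
      ≡⟨ ∑-cong size (λ a → ∑-≋ (a · u)) ⟩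
    ∑ size (λ _ → 1)
      ≡⟨ ≡.trans (∑-const size 1) (ℕ.*-identityʳ q) ⟩
    q ∎
    where open ≡.≡-Reasoning

  ∑-Zero : ∑ V-size (𝟙 ∘ Zero?) ≡ 1
  ∑-Zero = ∑-≋ λ _ → 0#

  ∑-translate : ∀ {f} → f Preserves _≋_ ⟶ _≡_ → ∀ w → ∑ V-size (λ v → f (v +ᵥ w)) ≡ ∑ V-size f
  ∑-translate f-cong w = ∑-reindex V-size f-cong (_+ᵥ w) (λ v i → v i - w i)
    (λ v≋v′ i → +-congʳ (v≋v′ i)) (λ v≋v′ i → +-congʳ (v≋v′ i))
    (λ v i → //-rightDividesˡ (w i) (v i))
    (λ v i → //-rightDividesʳ (w i) (v i))

  ∑-scale : ∀ {f} → f Preserves _≋_ ⟶ _≡_ → ∀ {a} → a # 0# → ∑ V-size (λ v → f (a · v)) ≡ ∑ V-size f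
  ∑-scale f-cong {a} a#0 with inverse a#0
  ... | b , ba≈1 = ∑-reindex V-size f-cong (a ·_) (b ·_)
    (λ v≋v′ i → *-congˡ (v≋v′ i)) (λ v≋v′ i → *-congˡ (v≋v′ i))
    (λ v i → cancel (*-Props.x∙yz≈yx∙z a b (v i)))
    (λ v i → cancel (sym (*-assoc b a (v i))))
    where
    cancel : ∀ {x v} → x ≈ (b * a) * v → x ≈ v
    cancel eq = trans eq (trans (*-congʳ ba≈1) (*-identityˡ _))

  combination-injective : ∀ {u v} → Nonzero u → ¬ v ∈⟨ u ⟩ → ∀ {a b a′ b′} →
    a · u +ᵥ b · v ≋ a′ · u +ᵥ b′ · v → a ≈ a′ × b ≈ b′
  combination-injective {u} {v} (j , uⱼ#0) v∉⟨u⟩ {a} {b} {a′} {b′} eq = a≈a′ , b≈b′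
    where
    b-b′≈0 : b - b′ ≈ 0#
    b-b′≈0 = ¬#0⇒≈0 λ b-b′#0 → let (w , w[b-b′]≈1) = inverse b-b′#0 in
      -- If b and b′ differ, the equation can be solved for v, giving v = (a′ - a)/(b - b′) u.
      v∉⟨u⟩ (w * (a′ - a) , λ i → begin
        v i                                   ≈⟨ *-identityˡ _ ⟨
        1# * v i                              ≈⟨ *-congʳ w[b-b′]≈1 ⟨
        (w * (b - b′)) * v i                  ≈⟨ trans (*-assoc w (b - b′) (v i)) (*-congˡ ([y-z]x≈yx-zx (v i) b b′)) ⟩
        w * (b * v i - b′ * v i)              ≈⟨ *-congˡ (exchange (eq i)) ⟩
        w * (a′ * u i - a * u i)              ≈⟨ trans (*-assoc w (a′ - a) (u i)) (*-congˡ ([y-z]x≈yx-zx (u i) a′ a)) ⟨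
        (w * (a′ - a)) * u i                  ∎)
      where open SetoidReasoning setoid

    b≈b′ : b ≈ b′
    b≈b′ = x∙y⁻¹≈ε⇒x≈y _ _ b-b′≈0

    a≈a′ : a ≈ a′
    a≈a′ = *-cancelʳ uⱼ#0 (+-cancelʳ (b * v j) (a * u j) (a′ * u j) (trans (eq j) (+-congˡ (*-congʳ (sym b≈b′)))))

-- The indicator of B on vectors, and intersections with a line.

module Counting {c ℓ₁ ℓ₂ s} (F : HeytingField c ℓ₁ ℓ₂) {q} (size : HasSize (HeytingField.setoid F) q) (n : ℕ)
                (B : PG.PointSet F n s) where

  open HeytingField F
  open HeytingProperties heytingCommutativeRing using (1#0)
  open FiniteField F size
  open Geometry F size n
  open PG F n
  open PointSet B using (respects; member?)
  open Setoid V-setoid using () renaming (_≈_ to _≋_; refl to ≋-refl; sym to ≋-sym; trans to ≋-trans)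
  private module P = Setoid pointSetoid

  InB : Pred V _
  InB = Cone (Member B)

  opaque

    InB? : Decidable InB
    InB? v with Nonzero? v
    ... | no ¬nz = no (¬nz ∘ proj₁)
    -- A point contains its proof of being nonzero, and `nz′` need not be `nz`; `respects`
    -- identifies the two resulting points.
    ... | yes nz = map′ (nz ,_) (λ (nz′ , v∈B) → respects {v , nz′} {v , nz} (P.refl {v , nz}) v∈B) (member? (v , nz))

  χ : V → ℕ
  χ v = 𝟙 (InB? v)

  χ-cong-∼ : ∀ {v w} → v ∼ w → w ∼ v → χ v ≡ χ w
  χ-cong-∼ v∼w w∼v = 𝟙-cong (InB? _) (InB? _) (Cone-resp-∼ (λ {x} {y} → respects {x} {y}) w∼v)
                                                (Cone-resp-∼ (λ {x} {y} → respects {x} {y}) v∼w)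

  χ-cong : χ Preserves _≋_ ⟶ _≡_
  χ-cong v≋w = χ-cong-∼ (≋⇒∼ v≋w) (≋⇒∼ (≋-sym v≋w))

  χ-Zero : ∀ {v} → Zero v → χ v ≡ 0
  χ-Zero v≋0 = 𝟙-false (InB? _) λ (nz , _) → Zero⇒¬Nonzero v≋0 nz

  χ-scale : ∀ a v → χ (a · v) ≡ 𝟙 (#0? a) ℕ.* χ v
  χ-scale a v with #0? a
  ... | yes a#0 = ≡.trans (χ-cong-∼ av∼v v∼av) (≡.sym (≡.trans (≡.cong (ℕ._* χ v) (𝟙-true (yes a#0) a#0)) (ℕ.*-identityˡ _)))
    where
    av∼v : a · v ∼ v
    av∼v = a , a#0 , ≋-refl

    v∼av : v ∼ a · v
    v∼av with b , ba≈1 ← inverse a#0 =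
      b , unit⇒#0 (trans (*-comm a b) ba≈1) ,
      λ i → sym (trans (sym (*-assoc b a _)) (trans (*-congʳ ba≈1) (*-identityˡ _)))
  ... | no ¬a#0 = ≡.trans (χ-Zero λ i → trans (*-congʳ (¬#0⇒≈0 ¬a#0)) (zeroˡ _))
                          (≡.sym (≡.cong (ℕ._* χ v) (𝟙-false (no ¬a#0) ¬a#0)))

  -- If u and v are independent: the number of points of B on ⟨u, v⟩ other than ⟨u⟩.
  A : V → V → ℕ
  A u v = ∑ size λ c → χ (v +ᵥ c · u)

  A-Zero : ∀ {u} → Zero u → ∀ v → A u v ≡ q ℕ.* χ v
  A-Zero u≋0 v = ≡.trans (∑-cong size λ c → χ-cong λ i →
    trans (+-congˡ (trans (*-congˡ (u≋0 i)) (zeroʳ c))) (+-identityʳ _)) (∑-const size (χ v))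

  module _ {r} (q≡1+r : q ≡ 1 ℕ.+ r) where

    ∑χ : ∀ {b} → Card (Member B) b → ∑ V-size χ ≡ r ℕ.* b
    ∑χ {b} card = begin
      ∑ V-size χ
        ≡⟨ ∑-cong V-size (λ v → 𝟙-cone (λ {x} {y} → respects {x} {y}) card v (InB? v) id id) ⟨
      ∑ V-size (λ v → ∑ card λ Y → 𝟙 (v ∼? proj₁ (proj₁ Y)))
        ≡⟨ ∑-swap V-size card _ ⟩
      ∑ card (λ Y → ∑ V-size λ v → 𝟙 (v ∼? proj₁ (proj₁ Y)))
        ≡⟨ ∑-cong card (λ Y → ∑-∼ q≡1+r (proj₂ (proj₁ Y))) ⟩
      ∑ card (λ _ → r)
        ≡⟨ ∑-const card r ⟩
      b ℕ.* r
        ≡⟨ ℕ.*-comm b r ⟩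
      r ℕ.* b ∎
      where open ≡.≡-Reasoning

    -- If v = d u, then v + c u = (c + d) u runs through all multiples of `u`: the zero vector
    -- contributes nothing, and each of the r others contributes `χ u`.
    A-dependent : ∀ {u v} → v ∈⟨ u ⟩ → A u v ≡ r ℕ.* χ u
    A-dependent {u} {v} (d , v≋du) = begin
      ∑ size (λ c → χ (v +ᵥ c · u))
        ≡⟨ ∑-cong size (λ c → χ-cong λ i → trans (+-comm _ _) (trans (+-congˡ (v≋du i)) (sym (distribʳ _ _ _)))) ⟩
      ∑ size (λ c → χ ((c + d) · u))
        ≡⟨ ∑-reindex size {λ c → χ (c · u)} (λ c≈c′ → χ-cong λ i → *-congʳ c≈c′)
             (_+ d) (_- d) +-congʳ +-congʳ (//-rightDividesˡ d) (//-rightDividesʳ d) ⟩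
      ∑ size (λ c → χ (c · u))
        ≡⟨ ∑-cong size (λ c → χ-scale c u) ⟩
      ∑ size (λ c → 𝟙 (#0? c) ℕ.* χ u)
        ≡⟨ ∑-*ʳ size (χ u) (λ c → 𝟙 (#0? c)) ⟩
      ∑ size (𝟙 ∘ #0?) ℕ.* χ u
        ≡⟨ ≡.cong (ℕ._* χ u) (∑#0 q≡1+r) ⟩
      r ℕ.* χ u ∎
      where open ≡.≡-Reasoning

  module _ {u v : V} (u≢0 : Nonzero u) (v∉⟨u⟩ : ¬ v ∈⟨ u ⟩) where

    v≢0 : Nonzero v
    v≢0 with Nonzero? v
    ... | yes nz = nz
    ... | no ¬nz = contradiction (0# , λ i → trans (¬Nonzero⇒Zero ¬nz i) (sym (zeroˡ _))) v∉⟨u⟩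

    line : Line
    line = record
      { P   = u , u≢0
      ; Q   = v , v≢0
      ; P≉Q = λ u≈v → let (a , _ , v≋au) = P.sym {u , u≢0} {v , v≢0} u≈v in v∉⟨u⟩ (a , v≋au)
      }

    distribute : ∀ t a b → t · (a · u +ᵥ b · v) ≋ (t * a) · u +ᵥ (t * b) · v
    distribute t a b i = trans (distribˡ t _ _) (+-cong (sym (*-assoc t a _)) (sym (*-assoc t b _)))

    private
      B∩L : Pred Point _
      B∩L = Member B ∩ OnLine line

      B∩L-resp : B∩L Respects _≈ₚ_
      B∩L-resp {x} {y} x≈y (x∈B , a , b , x≋au+bv) with t , _ , y≋tx ← P.sym {x} {y} x≈y =
        respects {x} {y} x≈y x∈B , t * a , t * b ,
        ≋-trans y≋tx (≋-trans (λ i → *-congˡ (x≋au+bv i)) (distribute t a b))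

    module _ {y a b} (y≢0 : Nonzero y) (y≋au+bv : y ≋ a · u +ᵥ b · v) where

      expand : ∀ t → t · y ≋ (t * a) · u +ᵥ (t * b) · v
      expand t = ≋-trans (λ i → *-congˡ (y≋au+bv i)) (distribute t a b)

      coefficients : ∀ {c t} → v +ᵥ c · u ≋ t · y → c ≈ t * a × 1# ≈ t * b
      coefficients eq = combination-injective u≢0 v∉⟨u⟩
        (≋-trans (λ i → trans (+-comm _ _) (+-congʳ (*-identityˡ _))) (≋-trans eq (expand _)))

      -- The vectors v + c u represent exactly the points a u + b v with b nonzero, each for a
      -- single c. With `𝟙-∼-base` for b = 0, every point of the line is accounted for once.
      ∑-∼-affine : ∑ size (λ c → 𝟙 ((v +ᵥ c · u) ∼? y)) ≡ 𝟙 (#0? b)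
      ∑-∼-affine = ∑-unique size
        (λ c≈c′ (t , t#0 , eq) → t , t#0 , λ i → trans (+-congˡ (*-congʳ (sym c≈c′))) (eq i))
        (λ c → (v +ᵥ c · u) ∼? y) (#0? b)
        -- Scaling `y` by t = 1/b makes the coefficient of `v` equal to 1, so c = a/b.
        (λ b#0 → let (t , tb≈1) = inverse b#0 in
          t * a , t , unit⇒#0 (trans (*-comm b t) tb≈1) ,
          λ i → trans (+-comm _ _) (trans (+-congˡ (trans (sym (*-identityˡ _)) (*-congʳ (sym tb≈1)))) (sym (expand t i))))
        (λ (t , _ , eq) → unit⇒#0 (sym (proj₂ (coefficients eq))))
        (λ (t , _ , eq) (t′ , _ , eq′) →
          let (c≈ta , 1≈tb) = coefficients eq ; (c′≈t′a , 1≈t′b) = coefficients eq′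
              t≈t′ = *-cancelʳ (unit⇒#0 (sym 1≈tb)) (trans (sym 1≈tb) 1≈t′b)
          in trans c≈ta (trans (*-congʳ t≈t′) (sym c′≈t′a)))

      𝟙-∼-base : 𝟙 (u ∼? y) ≡ 𝟙 (b ≟ 0#)
      𝟙-∼-base = 𝟙-cong (u ∼? y) (b ≟ 0#)
        (λ (t , t#0 , u≋ty) → *-cancelʳ t#0 (trans (*-comm b t) (trans (sym (0≈tb u≋ty)) (sym (zeroˡ t)))))
        (λ b≈0 → P.sym {y , y≢0} {u , u≢0} (a , a#0 b≈0 , y≋au b≈0))
        where
        0≈tb : ∀ {t} → u ≋ t · y → 0# ≈ t * b
        0≈tb u≋ty = proj₂ (combination-injective u≢0 v∉⟨u⟩ {1#}
          (≋-trans (λ i → trans (+-cong (*-identityˡ _) (zeroˡ _)) (+-identityʳ _)) (≋-trans u≋ty (expand _))))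

        y≋au : b ≈ 0# → y ≋ a · u
        y≋au b≈0 i = trans (y≋au+bv i) (trans (+-congˡ (trans (*-congʳ b≈0) (zeroˡ _))) (+-identityʳ _))

        a#0 : b ≈ 0# → a # 0#
        a#0 b≈0 with #0? a
        ... | yes a#0 = a#0
        ... | no ¬a#0 = contradiction y≢0
          (Zero⇒¬Nonzero λ i → trans (y≋au b≈0 i) (trans (*-congʳ (¬#0⇒≈0 ¬a#0)) (zeroˡ _)))

    -- Swapping the sums leaves, for each point a u + b v of B on the line, the indicator of b
    -- nonzero (from `A`) plus that of b = 0 (from `χ u`), which is 1.
    A-independent : ∀ {k} → Card B∩L k → A u v ℕ.+ χ u ≡ k
    A-independent {k} card = begin
      ∑ size (λ c → χ (v +ᵥ c · u)) ℕ.+ χ u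
        ≡⟨ ≡.cong₂ ℕ._+_ (∑-cong size λ c → χ-line c 1# (λ i → trans (+-comm _ _) (+-congˡ (sym (*-identityˡ _)))))
                         (χ-line 1# 0# λ i → sym (trans (+-cong (*-identityˡ _) (zeroˡ _)) (+-identityʳ _))) ⟩
      ∑ size (λ c → ∑ card λ Y → 𝟙 ((v +ᵥ c · u) ∼? vec Y)) ℕ.+ ∑ card (λ Y → 𝟙 (u ∼? vec Y))
        ≡⟨ ≡.cong (ℕ._+ ∑ card (λ Y → 𝟙 (u ∼? vec Y))) (∑-swap size card _) ⟩
      ∑ card (λ Y → ∑ size λ c → 𝟙 ((v +ᵥ c · u) ∼? vec Y)) ℕ.+ ∑ card (λ Y → 𝟙 (u ∼? vec Y))
        ≡⟨ ∑-+ card _ _ ⟨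
      ∑ card (λ Y → ∑ size (λ c → 𝟙 ((v +ᵥ c · u) ∼? vec Y)) ℕ.+ 𝟙 (u ∼? vec Y))
        ≡⟨ ∑-cong card (λ {((y , y≢0) , _ , a , b , eq) →
             ≡.trans (≡.cong₂ ℕ._+_ (∑-∼-affine y≢0 eq) (𝟙-∼-base y≢0 eq)) (𝟙#0+𝟙≈0 b)}) ⟩
      ∑ card (λ _ → 1)
        ≡⟨ ≡.trans (∑-const card 1) (ℕ.*-identityʳ k) ⟩
      k ∎
      where
      open ≡.≡-Reasoning
      vec : ∃ B∩L → V
      vec Y = proj₁ (proj₁ Y)

      χ-line : ∀ {w} a b → w ≋ a · u +ᵥ b · v → χ w ≡ ∑ card λ Y → 𝟙 (w ∼? vec Y)
      χ-line {w} a b eq = ≡.sym (𝟙-cone (λ {x} {y} → B∩L-resp {x} {y}) card w (InB? w)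
        (λ (nz , w∈B) → nz , w∈B , a , b , eq) (λ (nz , w∈B , _) → nz , w∈B))

-- First and second moments of A over all pairs of vectors.

module Moments {c ℓ₁ ℓ₂ s} (F : HeytingField c ℓ₁ ℓ₂) {q} (size : HasSize (HeytingField.setoid F) q) (n : ℕ)
                (B : PG.PointSet F n s) {r} (q≡1+r : q ≡ 1 ℕ.+ r) where

  open HeytingField F using (Carrier; _≈_; _#_; _+_; _*_; _-_; 0#; refl; sym; trans; +-comm; +-assoc; +-identityʳ; +-congˡ; +-congʳ; *-congʳ; distribʳ; zeroˡ)
  open FiniteField F size
  open Geometry F size n
  open PG F n
  open Counting F size n B
  open Setoid V-setoid using () renaming (_≈_ to _≋_; refl to ≋-refl; sym to ≋-sym; trans to ≋-trans)

  N β : ℕ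
  N = q ℕ.^ suc n
  β = ∑ V-size χ

  ∑A : ∀ u → ∑ V-size (A u) ≡ q ℕ.* β
  ∑A u = begin
    ∑ V-size (λ v → ∑ size λ c → χ (v +ᵥ c · u))   ≡⟨ ∑-swap V-size size _ ⟩
    ∑ size (λ c → ∑ V-size λ v → χ (v +ᵥ c · u))   ≡⟨ ∑-cong size (λ c → ∑-translate χ-cong (c · u)) ⟩
    ∑ size (λ _ → β)                               ≡⟨ ∑-const size β ⟩
    q ℕ.* β                                        ∎
    where open ≡.≡-Reasoning

  M : V → ℕ
  M u = ∑ V-size λ v → A u v ℕ.* A u v

  M-Zero : ∀ {u} → Zero u → M u ≡ q ℕ.* (q ℕ.* β)
  M-Zero {u} u≋0 = begin
    ∑ V-size (λ v → A u v ℕ.* A u v)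
      ≡⟨ ∑-cong V-size (λ v → ≡.trans (≡.cong₂ ℕ._*_ (A-Zero u≋0 v) (A-Zero u≋0 v))
           (≡.trans (square q (χ v)) (≡.cong (q ℕ.* q ℕ.*_) (𝟙-idem (InB? v))))) ⟩
    ∑ V-size (λ v → q ℕ.* q ℕ.* χ v)
      ≡⟨ ∑-*ˡ V-size (q ℕ.* q) χ ⟩
    q ℕ.* q ℕ.* β
      ≡⟨ ℕ.*-assoc q q β ⟩
    q ℕ.* (q ℕ.* β) ∎
    where
    open ≡.≡-Reasoning
    square : ∀ q x → (q ℕ.* x) ℕ.* (q ℕ.* x) ≡ q ℕ.* q ℕ.* (x ℕ.* x)
    square = solve-∀

  ∑-pull : ∀ (f : V → V → Carrier → ℕ) →
           ∑ V-size (λ u → ∑ V-size λ v → ∑ size (f u v)) ≡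
           ∑ size (λ a → ∑ V-size λ u → ∑ V-size λ v → f u v a)
  ∑-pull f = ≡.trans (∑-cong V-size λ u → ∑-swap V-size size (f u)) (∑-swap V-size size _)

  pairs : Carrier → ℕ
  pairs a = ∑ V-size λ v → χ v ℕ.* ∑ V-size λ u → χ (v +ᵥ a · u)

  pairs-cong : pairs Preserves _≈_ ⟶ _≡_
  pairs-cong a≈b = ∑-cong V-size λ v → ≡.cong (χ v ℕ.*_) (∑-cong V-size λ u → χ-cong λ i → +-congˡ (*-congʳ a≈b))

  -- For invertible `a` the vector v + a u runs through the whole space with `u`, so the two factors
  -- decouple. For a = 0 it is `v` itself, and `u` is free.
  pairs-≡ : ∀ a → pairs a ≡ 𝟙 (#0? a) ℕ.* (β ℕ.* β) ℕ.+ 𝟙 (a ≟ 0#) ℕ.* (N ℕ.* β)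
  pairs-≡ a with #0? a
  ... | yes a#0 = ≡.trans
    (begin
      ∑ V-size (λ v → χ v ℕ.* ∑ V-size λ u → χ (v +ᵥ a · u))
        ≡⟨ ∑-cong V-size (λ v → ≡.cong (χ v ℕ.*_) (≡.trans
             (∑-scale {λ u → χ (v +ᵥ u)} (λ u≋u′ → χ-cong λ i → +-congˡ (u≋u′ i)) a#0)
             (≡.trans (∑-cong V-size λ u → χ-cong λ i → +-comm _ _) (∑-translate χ-cong v)))) ⟩
      ∑ V-size (λ v → χ v ℕ.* β)
        ≡⟨ ∑-*ʳ V-size β χ ⟩
      β ℕ.* β ∎)
    (≡.sym (≡.trans (≡.cong₂ (λ x y → x ℕ.* (β ℕ.* β) ℕ.+ y ℕ.* (N ℕ.* β))
      (𝟙-true (yes a#0) a#0) (𝟙-false (a ≟ 0#) λ a≈0 → ≈0⇒¬#0 a≈0 a#0))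
      (ℕ.+-identityʳ _ ⟨≡⟩ ℕ.*-identityˡ _)))
    where
    open ≡.≡-Reasoning
    _⟨≡⟩_ = ≡.trans
  ... | no ¬a#0 = ≡.trans
    (begin
      ∑ V-size (λ v → χ v ℕ.* ∑ V-size λ u → χ (v +ᵥ a · u))
        ≡⟨ ∑-cong V-size (λ v → ≡.cong (χ v ℕ.*_) (≡.trans
             (∑-cong V-size λ u → χ-cong λ i → trans (+-congˡ (trans (*-congʳ (¬#0⇒≈0 ¬a#0)) (zeroˡ _))) (+-identityʳ _))
             (∑-const V-size (χ v)))) ⟩
      ∑ V-size (λ v → χ v ℕ.* (N ℕ.* χ v))
        ≡⟨ ∑-cong V-size (λ v → ≡.trans (x*[m*x] (χ v) N) (≡.cong (N ℕ.*_) (𝟙-idem (InB? v)))) ⟩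
      ∑ V-size (λ v → N ℕ.* χ v)
        ≡⟨ ∑-*ˡ V-size N χ ⟩
      N ℕ.* β ∎)
    (≡.sym (≡.trans (≡.cong₂ (λ x y → x ℕ.* (β ℕ.* β) ℕ.+ y ℕ.* (N ℕ.* β))
      (𝟙-false (no ¬a#0) ¬a#0) (𝟙-true (a ≟ 0#) (¬#0⇒≈0 ¬a#0)))
      (ℕ.*-identityˡ _)))
    where
    open ≡.≡-Reasoning
    x*[m*x] : ∀ x m → x ℕ.* (m ℕ.* x) ≡ m ℕ.* (x ℕ.* x)
    x*[m*x] = solve-∀

  ∑-pairs : ∑ size pairs ≡ N ℕ.* β ℕ.+ r ℕ.* (β ℕ.* β)
  ∑-pairs = begin
    ∑ size pairs
      ≡⟨ ∑-cong size pairs-≡ ⟩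
    ∑ size (λ a → 𝟙 (#0? a) ℕ.* (β ℕ.* β) ℕ.+ 𝟙 (a ≟ 0#) ℕ.* (N ℕ.* β))
      ≡⟨ ∑-+ size _ _ ⟩
    ∑ size (λ a → 𝟙 (#0? a) ℕ.* (β ℕ.* β)) ℕ.+ ∑ size (λ a → 𝟙 (a ≟ 0#) ℕ.* (N ℕ.* β))
      ≡⟨ ≡.cong₂ ℕ._+_ (∑-*ʳ size (β ℕ.* β) (λ a → 𝟙 (#0? a))) (∑-*ʳ size (N ℕ.* β) (λ a → 𝟙 (a ≟ 0#))) ⟩
    ∑ size (λ a → 𝟙 (#0? a)) ℕ.* (β ℕ.* β) ℕ.+ ∑ size (λ a → 𝟙 (a ≟ 0#)) ℕ.* (N ℕ.* β)
      ≡⟨ ≡.cong₂ (λ x y → x ℕ.* (β ℕ.* β) ℕ.+ y ℕ.* (N ℕ.* β)) (∑#0 q≡1+r) ∑≈0 ⟩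
    r ℕ.* (β ℕ.* β) ℕ.+ 1 ℕ.* (N ℕ.* β)
      ≡⟨ ≡.cong (r ℕ.* (β ℕ.* β) ℕ.+_) (ℕ.*-identityˡ _) ⟩
    r ℕ.* (β ℕ.* β) ℕ.+ N ℕ.* β
      ≡⟨ ℕ.+-comm _ (N ℕ.* β) ⟩
    N ℕ.* β ℕ.+ r ℕ.* (β ℕ.* β) ∎
    where open ≡.≡-Reasoning

  -- Translating `v` by - a u leaves only the difference of the two coefficients.
  correlation : ∀ a d → ∑ V-size (λ u → ∑ V-size λ v → χ (v +ᵥ a · u) ℕ.* χ (v +ᵥ d · u)) ≡ pairs (d - a)
  correlation a d = begin
    ∑ V-size (λ u → ∑ V-size λ v → χ (v +ᵥ a · u) ℕ.* χ (v +ᵥ d · u))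
      ≡⟨ ∑-cong V-size (λ u → ≡.trans
           (∑-cong V-size λ v → ≡.cong (χ (v +ᵥ a · u) ℕ.*_) (χ-cong (shift u v)))
           (∑-translate {λ v → χ v ℕ.* χ (v +ᵥ (d - a) · u)}
              (λ v≋v′ → ≡.cong₂ ℕ._*_ (χ-cong v≋v′) (χ-cong λ i → +-congʳ (v≋v′ i))) (a · u))) ⟩
    ∑ V-size (λ u → ∑ V-size λ v → χ v ℕ.* χ (v +ᵥ (d - a) · u))
      ≡⟨ ∑-swap V-size V-size _ ⟩
    ∑ V-size (λ v → ∑ V-size λ u → χ v ℕ.* χ (v +ᵥ (d - a) · u))
      ≡⟨ ∑-cong V-size (λ v → ∑-*ˡ V-size (χ v) _) ⟩
    pairs (d - a) ∎
    where
    open ≡.≡-Reasoning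
    shift : ∀ u v → v +ᵥ d · u ≋ (v +ᵥ a · u) +ᵥ (d - a) · u
    shift u v i = sym (trans (+-assoc _ _ _) (+-congˡ (trans (sym (distribʳ _ _ _))
                    (*-congʳ (trans (+-comm _ _) (//-rightDividesˡ a d))))))

  -- Expanding the square gives a double sum over coefficients a and d. Its terms depend on d - a
  -- alone, hence the factor q in front of `∑ size pairs`.
  ∑M : ∑ V-size M ≡ q ℕ.* (N ℕ.* β ℕ.+ r ℕ.* (β ℕ.* β))
  ∑M = begin
    ∑ V-size (λ u → ∑ V-size λ v → A u v ℕ.* A u v)
      ≡⟨ ∑-cong V-size (λ u → ∑-cong V-size λ v → ≡.trans (≡.sym (∑-*ʳ size (A u v) _))
           (∑-cong size λ a → ≡.sym (∑-*ˡ size (χ (v +ᵥ a · u)) _))) ⟩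
    ∑ V-size (λ u → ∑ V-size λ v → ∑ size λ a → ∑ size λ d → χ (v +ᵥ a · u) ℕ.* χ (v +ᵥ d · u))
      ≡⟨ ∑-pull _ ⟩
    ∑ size (λ a → ∑ V-size λ u → ∑ V-size λ v → ∑ size λ d → χ (v +ᵥ a · u) ℕ.* χ (v +ᵥ d · u))
      ≡⟨ ∑-cong size (λ a → ∑-pull _) ⟩
    ∑ size (λ a → ∑ size λ d → ∑ V-size λ u → ∑ V-size λ v → χ (v +ᵥ a · u) ℕ.* χ (v +ᵥ d · u))
      ≡⟨ ∑-cong size (λ a → ∑-cong size λ d → correlation a d) ⟩
    ∑ size (λ a → ∑ size λ d → pairs (d - a))
      ≡⟨ ∑-cong size (λ a → ∑-reindex size pairs-cong (_- a) (_+ a) +-congʳ +-congʳ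
           (//-rightDividesʳ a) (//-rightDividesˡ a)) ⟩
    ∑ size (λ _ → ∑ size pairs)
      ≡⟨ ∑-const size _ ⟩
    q ℕ.* ∑ size pairs
      ≡⟨ ≡.cong (q ℕ.*_) ∑-pairs ⟩
    q ℕ.* (N ℕ.* β ℕ.+ r ℕ.* (β ℕ.* β)) ∎
    where open ≡.≡-Reasoning

  ζ off : V → ℕ
  ζ u = 𝟙 (Zero? u)
  off u = 𝟙 (Nonzero? u ×-dec ¬? (InB? u))

  -- Each case carries the values of all three indicators, so that one case distinction evaluates
  -- every weight at `u`.
  data Position (u : V) : Set (c ⊔ ℓ₁ ⊔ ℓ₂ ⊔ s) where
    zero-vector : Zero u → χ u ≡ 0 → ζ u ≡ 1 → off u ≡ 0 → Position u
    inside      : InB u → χ u ≡ 1 → ζ u ≡ 0 → off u ≡ 0 → Position u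
    outside     : Nonzero u → ¬ InB u → χ u ≡ 0 → ζ u ≡ 0 → off u ≡ 1 → Position u

  position : ∀ u → Position u
  position u = by (Nonzero? u) (InB? u)
    where
    by : Dec (Nonzero u) → Dec (InB u) → Position u
    by (no ¬nz) _ = zero-vector (¬Nonzero⇒Zero ¬nz)
      (𝟙-false (InB? u) (¬nz ∘ proj₁)) (𝟙-true (Zero? u) (¬Nonzero⇒Zero ¬nz)) (𝟙-false (Nonzero? u ×-dec ¬? (InB? u)) (¬nz ∘ proj₁))
    by (yes nz) (yes u∈B) = inside u∈B
      (𝟙-true (InB? u) u∈B) (𝟙-false (Zero? u) λ z → Zero⇒¬Nonzero z nz) (𝟙-false (Nonzero? u ×-dec ¬? (InB? u)) λ (_ , u∉B) → u∉B u∈B)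
    by (yes nz) (no u∉B) = outside nz u∉B
      (𝟙-false (InB? u) u∉B) (𝟙-false (Zero? u) λ z → Zero⇒¬Nonzero z nz) (𝟙-true (Nonzero? u ×-dec ¬? (InB? u)) (nz , u∉B))

  ρ : ℕ
  ρ = ∑ V-size off

  ρ+β+1≡N : ρ ℕ.+ β ℕ.+ 1 ≡ N
  ρ+β+1≡N = begin
    ρ ℕ.+ β ℕ.+ 1                                  ≡⟨ ≡.cong (ρ ℕ.+ β ℕ.+_) ∑-Zero ⟨
    ρ ℕ.+ β ℕ.+ ∑ V-size ζ                         ≡⟨ ≡.cong (ℕ._+ ∑ V-size ζ) (∑-+ V-size off χ) ⟨
    ∑ V-size (λ u → off u ℕ.+ χ u) ℕ.+ ∑ V-size ζ  ≡⟨ ∑-+ V-size _ ζ ⟨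
    ∑ V-size (λ u → off u ℕ.+ χ u ℕ.+ ζ u)         ≡⟨ ∑-cong V-size (λ u → one (position u)) ⟩
    ∑ V-size (λ _ → 1)                             ≡⟨ ≡.trans (∑-const V-size 1) (ℕ.*-identityʳ N) ⟩
    N                                              ∎
    where
    open ≡.≡-Reasoning
    one : ∀ {u} → Position u → off u ℕ.+ χ u ℕ.+ ζ u ≡ 1
    one (zero-vector _ χ≡ ζ≡ off≡) rewrite χ≡ | ζ≡ | off≡ = ≡.refl
    one (inside _ χ≡ ζ≡ off≡)      rewrite χ≡ | ζ≡ | off≡ = ≡.refl
    one (outside _ _ χ≡ ζ≡ off≡)   rewrite χ≡ | ζ≡ | off≡ = ≡.refl

  module _ {E} (E>3 : E ℕ.> 3) (mod : MeetsLinesIn1Mod B E) where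

    line-≡1 : ∀ {u v} → Nonzero u → ¬ v ∈⟨ u ⟩ → E ∣ ∣ A u v ℕ.+ χ u - 1 ∣
    line-≡1 u≢0 v∉⟨u⟩ with k , card , E∣ ← mod (line u≢0 v∉⟨u⟩) =
      ≡.subst (λ k → E ∣ ∣ k - 1 ∣) (≡.sym (A-independent u≢0 v∉⟨u⟩ card)) E∣

    module _ {u} (u≢0 : Nonzero u) where

      δ : V → ℕ
      δ v = 𝟙 (v ∈⟨ u ⟩?)

      ∑δ* : ∀ k → ∑ V-size (λ v → δ v ℕ.* k) ≡ q ℕ.* k
      ∑δ* k = ≡.trans (∑-*ʳ V-size k δ) (≡.cong (ℕ._* k) (∑-∈⟨⟩ u≢0))

      ∑-affine : ∀ m k → ∑ V-size (λ v → m ℕ.* A u v ℕ.+ δ v ℕ.* k) ≡ m ℕ.* (q ℕ.* β) ℕ.+ q ℕ.* k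
      ∑-affine m k = ≡.trans (∑-+ V-size _ _) (≡.cong₂ ℕ._+_
        (≡.trans (∑-*ˡ V-size m (A u)) (≡.cong (m ℕ.*_) (∑A u))) (∑δ* k))

      open ℕ.≤-Reasoning

      -- On the line ⟨u, v⟩ with k points of B, A u v = k - 1 if u is in B,
      -- and (k - 1)(k - 1 - E) ≥ 0 becomes E A ≤ A².  The δ terms make it an
      -- equality if v is on ⟨u⟩, where A u v = r.
      secants-through : InB u → E ℕ.* (q ℕ.* β) ℕ.+ q ℕ.* (r ℕ.* r) ℕ.≤ M u ℕ.+ q ℕ.* (E ℕ.* r)
      secants-through u∈B = begin
        E ℕ.* (q ℕ.* β) ℕ.+ q ℕ.* (r ℕ.* r)
          ≡⟨ ∑-affine E (r ℕ.* r) ⟨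
        ∑ V-size (λ v → E ℕ.* A u v ℕ.+ δ v ℕ.* (r ℕ.* r))
          ≤⟨ ∑-mono-≤ V-size pointwise ⟩
        ∑ V-size (λ v → A u v ℕ.* A u v ℕ.+ δ v ℕ.* (E ℕ.* r))
          ≡⟨ ≡.trans (∑-+ V-size _ _) (≡.cong (M u ℕ.+_) (∑δ* (E ℕ.* r))) ⟩
        M u ℕ.+ q ℕ.* (E ℕ.* r) ∎
        where
        χu≡1 : χ u ≡ 1
        χu≡1 = 𝟙-true (InB? u) u∈B

        pointwise : ∀ v → E ℕ.* A u v ℕ.+ δ v ℕ.* (r ℕ.* r) ℕ.≤ A u v ℕ.* A u v ℕ.+ δ v ℕ.* (E ℕ.* r)
        pointwise v with v ∈⟨ u ⟩?
        ... | yes v∈⟨u⟩ rewrite 𝟙-true (yes v∈⟨u⟩) v∈⟨u⟩ | A-dependent q≡1+r v∈⟨u⟩ | χu≡1 =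
          ℕ.≤-reflexive (identity E r)
          where
          identity : ∀ E r → E ℕ.* (r ℕ.* 1) ℕ.+ 1 ℕ.* (r ℕ.* r) ≡ (r ℕ.* 1) ℕ.* (r ℕ.* 1) ℕ.+ 1 ℕ.* (E ℕ.* r)
          identity = solve-∀
        ... | no v∉⟨u⟩ rewrite 𝟙-false (no v∉⟨u⟩) v∉⟨u⟩ = ℕ.+-monoˡ-≤ 0 (∣⇒*≤* E∣A)
          where
          E∣A : E ∣ A u v
          E∣A = ≡.subst (E ∣_) (≡.trans (≡.cong (λ x → ∣ A u v ℕ.+ x - 1 ∣) χu≡1)
                                        (≡.trans (≡.cong ∣_- 1 ∣ (ℕ.+-comm (A u v) 1)) (ℕ.∣-∣-identityʳ (A u v))))
                               (line-≡1 u≢0 v∉⟨u⟩)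

      -- Here `A u v` is the full count k on the line, so the inequality keeps its constant term 1 +
      -- E. On the q vectors of ⟨u⟩ the value of `A` is 0, and the δ term restores equality there
      -- instead of leaving a slack of 1 + E.
      secants-off : ¬ InB u → (2 ℕ.+ E) ℕ.* (q ℕ.* β) ℕ.+ q ℕ.* (1 ℕ.+ E) ℕ.≤ M u ℕ.+ N ℕ.* (1 ℕ.+ E)
      secants-off u∉B = begin
        (2 ℕ.+ E) ℕ.* (q ℕ.* β) ℕ.+ q ℕ.* (1 ℕ.+ E)
          ≡⟨ ∑-affine (2 ℕ.+ E) (1 ℕ.+ E) ⟨
        ∑ V-size (λ v → (2 ℕ.+ E) ℕ.* A u v ℕ.+ δ v ℕ.* (1 ℕ.+ E))
          ≤⟨ ∑-mono-≤ V-size pointwise ⟩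
        ∑ V-size (λ v → A u v ℕ.* A u v ℕ.+ (1 ℕ.+ E))
          ≡⟨ ≡.trans (∑-+ V-size _ _) (≡.cong (M u ℕ.+_) (∑-const V-size (1 ℕ.+ E))) ⟩
        M u ℕ.+ N ℕ.* (1 ℕ.+ E) ∎
        where
        χu≡0 : χ u ≡ 0
        χu≡0 = 𝟙-false (InB? u) u∉B

        pointwise : ∀ v → (2 ℕ.+ E) ℕ.* A u v ℕ.+ δ v ℕ.* (1 ℕ.+ E) ℕ.≤ A u v ℕ.* A u v ℕ.+ (1 ℕ.+ E)
        pointwise v with v ∈⟨ u ⟩?
        ... | yes v∈⟨u⟩ rewrite 𝟙-true (yes v∈⟨u⟩) v∈⟨u⟩ | A-dependent q≡1+r v∈⟨u⟩ | χu≡0 =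
          ℕ.≤-reflexive (identity E r)
          where
          identity : ∀ E r → (2 ℕ.+ E) ℕ.* (r ℕ.* 0) ℕ.+ 1 ℕ.* (1 ℕ.+ E) ≡ (r ℕ.* 0) ℕ.* (r ℕ.* 0) ℕ.+ (1 ℕ.+ E)
          identity = solve-∀
        ... | no v∉⟨u⟩ rewrite 𝟙-false (no v∉⟨u⟩) v∉⟨u⟩ =
          ℕ.≤-trans (ℕ.≤-reflexive (ℕ.+-identityʳ _)) (≡1-mod⇒secant {k = A u v} E>3
            (≡.subst (λ k → E ∣ ∣ k - 1 ∣) (≡.trans (≡.cong (A u v ℕ.+_) χu≡0) (ℕ.+-identityʳ (A u v)))
               (line-≡1 u≢0 v∉⟨u⟩)))

    -- Each u contributes the bound on `M u` that fits its position, selected by the indicators. At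
    -- u = 0 the second moment is known exactly and equals `a₂`. On the right the terms `M u` add up
    -- to `∑M`.
    pairCount : PairCount q r E N β ρ
    pairCount = begin
      β ℕ.* a₁ ℕ.+ a₂ ℕ.+ ρ ℕ.* a₃
        ≡⟨ ≡.cong (λ x → β ℕ.* a₁ ℕ.+ x ℕ.+ ρ ℕ.* a₃) (≡.trans (≡.cong (ℕ._* a₂) ∑-Zero) (ℕ.*-identityˡ a₂)) ⟨
      β ℕ.* a₁ ℕ.+ ∑ V-size ζ ℕ.* a₂ ℕ.+ ρ ℕ.* a₃
        ≡⟨ ≡.trans (∑-+ V-size _ _) (≡.cong₂ ℕ._+_ (≡.trans (∑-+ V-size _ _) (≡.cong₂ ℕ._+_ (∑-*ʳ V-size a₁ χ) (∑-*ʳ V-size a₂ ζ))) (∑-*ʳ V-size a₃ off)) ⟨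
      ∑ V-size (λ u → χ u ℕ.* a₁ ℕ.+ ζ u ℕ.* a₂ ℕ.+ off u ℕ.* a₃)
        ≤⟨ ∑-mono-≤ V-size (λ u → pointwise (position u)) ⟩
      ∑ V-size (λ u → M u ℕ.+ χ u ℕ.* b₁ ℕ.+ off u ℕ.* b₃)
        ≡⟨ ≡.trans (∑-+ V-size _ _) (≡.cong₂ ℕ._+_ (≡.trans (∑-+ V-size _ _) (≡.cong₂ ℕ._+_ ∑M (∑-*ʳ V-size b₁ χ))) (∑-*ʳ V-size b₃ off)) ⟩
      q ℕ.* (N ℕ.* β ℕ.+ r ℕ.* (β ℕ.* β)) ℕ.+ β ℕ.* b₁ ℕ.+ ρ ℕ.* b₃ ∎
      where
      open ℕ.≤-Reasoning
      a₁ a₂ a₃ b₁ b₃ : ℕ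
      a₁ = E ℕ.* (q ℕ.* β) ℕ.+ q ℕ.* (r ℕ.* r)
      a₂ = q ℕ.* (q ℕ.* β)
      a₃ = (2 ℕ.+ E) ℕ.* (q ℕ.* β) ℕ.+ q ℕ.* (1 ℕ.+ E)
      b₁ = q ℕ.* (E ℕ.* r)
      b₃ = N ℕ.* (1 ℕ.+ E)

      weigh : ∀ {u x y z x′ y′ z′ m} → x ≡ x′ → y ≡ y′ → z ≡ z′ → M u ≡ m →
              x′ ℕ.* a₁ ℕ.+ y′ ℕ.* a₂ ℕ.+ z′ ℕ.* a₃ ℕ.≤ m ℕ.+ x′ ℕ.* b₁ ℕ.+ z′ ℕ.* b₃ →
              x ℕ.* a₁ ℕ.+ y ℕ.* a₂ ℕ.+ z ℕ.* a₃ ℕ.≤ M u ℕ.+ x ℕ.* b₁ ℕ.+ z ℕ.* b₃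
      weigh ≡.refl ≡.refl ≡.refl ≡.refl le = le

      pointwise : ∀ {u} → Position u →
                  χ u ℕ.* a₁ ℕ.+ ζ u ℕ.* a₂ ℕ.+ off u ℕ.* a₃ ℕ.≤ M u ℕ.+ χ u ℕ.* b₁ ℕ.+ off u ℕ.* b₃
      pointwise {u} (zero-vector u≋0 χ≡0 ζ≡1 off≡0) = weigh {u} χ≡0 ζ≡1 off≡0 (M-Zero u≋0)
        (ℕ.+-monoˡ-≤ 0 ℕ.≤-refl)
      pointwise {u} (inside u∈B χ≡1 ζ≡0 off≡0) = weigh {u} χ≡1 ζ≡0 off≡0 ≡.refl
        (ℕ.+-monoˡ-≤ 0 (ℕ.≤-trans (ℕ.≤-reflexive (ℕ.+-identityʳ _))
          (ℕ.≤-trans (ℕ.+-monoˡ-≤ 0 (secants-through (proj₁ u∈B) u∈B)) (ℕ.≤-reflexive (ℕ.+-assoc (M u) b₁ 0)))))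
      pointwise {u} (outside u≢0 u∉B χ≡0 ζ≡0 off≡1) = weigh {u} χ≡0 ζ≡0 off≡1 ≡.refl
        (ℕ.≤-trans (ℕ.+-monoˡ-≤ 0 (secants-off u≢0 u∉B)) (ℕ.≤-reflexive (≡.trans (ℕ.+-assoc (M u) b₃ 0)
          (≡.cong (ℕ._+ (b₃ ℕ.+ 0)) (≡.sym (ℕ.+-identityʳ (M u)))))))

-- Assembly.

open import Data.Integer.Base using (+_)
open import Data.Nat.Base using (_+_; _*_; _^_; _∸_; _≤_; _<_; _≥_; _>_)
open import Data.Rational.Base using (_/_)

-- The dimension is `suc m`, so that `q ^ m` is Q and `geometric r m` is x. Since q is at least 2, r
-- is nonzero and may be cancelled.
≡1-mod⇒size-bound :
  ∀ {c ℓ₁ ℓ₂ s} (F : HeytingField c ℓ₁ ℓ₂) q .{{_ : ℕ.NonTrivial q}} → HasSize (HeytingField.setoid F) q →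
  ∀ m → let open PG F (suc m) in
  (B : PointSet s) → ∀ {E} → E > 3 → MeetsLinesIn1Mod B E → ∀ {b} → Card (Member B) b →
  θ q m < b → b < 2 * q ^ m → E * b ≤ (E + 2) * q ^ m
≡1-mod⇒size-bound F q@(suc r@(suc _)) size m B {E} E>3 mod {b} card θ<b b<2Q =
  ≡.subst (λ Q → E * b ≤ (E + 2) * Q) (≡.sym q^m)
    (bound E>3 (≡.subst (_< b) (θ-geometric r m) θ<b) (≡.subst (λ Q → b < 2 * Q) q^m b<2Q)
      (pairCount⇒lineCount ρ
        -- The sums over vectors are put in closed form: β = r b, as a point is spanned by r
        -- vectors, and N = r Θ + 1.
        (≡.subst₂ (λ β N → ρ + β + 1 ≡ N) (∑χ ≡.refl card) N≡ ρ+β+1≡N)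
        (≡.subst₂ (λ β N → PairCount q r E N β ρ) (∑χ ≡.refl card) N≡ (pairCount E>3 mod))))
  where
  open Arithmetic r (geometric r m) E b using (bound; pairCount⇒lineCount)
  open Counting F size (suc m) B using (∑χ)
  open Moments F size (suc m) B ≡.refl using (ρ; ρ+β+1≡N; pairCount)

  q^m : q ^ m ≡ r * geometric r m + 1
  q^m = ^-geometric r m

  N≡ : q ^ (2 + m) ≡ r * geometric r (2 + m) + 1
  N≡ = ^-geometric r (2 + m)

theorem2 : ∀ {c ℓ₁ ℓ₂ s} (n : ℕ) → n ≥ 2 →
    (p h : ℕ) (p-prime : Prime p) (h≥1 : h ≥ 1) →
    let q = p ^ h
        instance _ = primePower-nonTrivial p-prime h≥1
    in
    (F : HeytingField c ℓ₁ ℓ₂) → HasSize (HeytingField.setoid F) q →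
    let open PG F n in
    (B : PointSet s) → IsMinimalBlocking B →
    (e : ℕ) →
    let instance _ = primePower-nonZero p-prime e in
    MeetsLinesIn1Mod B (p ^ e) →
    (∀ e′ → MeetsLinesIn1Mod B (p ^ e′) → e′ ≤ e) →
    p ^ e > 3 →
    (b : ℕ) → Card (Member B) b →
    θ q (n ∸ 1) < b → b < 2 * q ^ (n ∸ 1) →
    (+ b) / 1 ℚ.≤ (+ (q ^ (n ∸ 1))) / 1 ℚ.+ (+ (2 * q ^ (n ∸ 1))) / (p ^ e)
theorem2 (suc m) _ p h p-prime h≥1 F size B _ e mod _ E>3 b card θ<b b<2Q =
  *≤⇒/≤ (p ^ e) {{primePower-nonZero p-prime e}} b ((p ^ h) ^ m)
    (≡1-mod⇒size-bound F (p ^ h) {{primePower-nonTrivial p-prime h≥1}} size m B E>3 mod card θ<b b<2Q)
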